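{- For every integer $n\geq 90$, the $n$-cube $Q_n$ has five pairwise edge-disjoint symmetric chain decompositions.
   Context: The $n$-cube $Q_n$ is the poset of all subsets of $[n]=\{1,\dots,n\}$ ordered by inclusion, with width $a_n=\binom{n}{\lfloor n/2\rfloor}$. A symmetric chain decomposition (SCD) of $Q_n$ is a partition of $Q_n$ into $a_n$ chains each of which is symmetric (its minimal and maximal elements have sizes $k$ and $n-k$ for some $k$) and saturated (it contains a set of every size between these). An edge of $Q_n$ is a cover relation $x\subseteq y$ with $|y|=|x|+1$; a chain uses an edge $(x,y)$ if it contains both $x$ and $y$. Two SCDs are edge-disjoint if no edge is used by a chain of both decompositions. -}

module Defs where

open import Data.Nat using (ℕ; suc; _+_; _/_)
open import Data.Nat.Combinatorics using (_C_)
open import Data.Fin using (Fin)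
open import Data.Fin.Subset using (Subset; _⊆_; ∣_∣)
open import Data.List using (List; length; concat; map)
open import Data.List.NonEmpty using (List⁺; toList; head; last)
open import Data.List.Membership.Propositional using (_∈_)
open import Data.List.Relation.Unary.Any using (Any)
open import Data.List.Relation.Unary.Linked using (Linked)
open import Data.List.Relation.Unary.Unique.Propositional using (Unique)
open import Data.Product using (_×_; ∃; ∃-syntax)
open import Relation.Binary.PropositionalEquality using (_≡_; _≢_)
open import Relation.Nullary using (¬_)

-- The n-cube Q_n: subsets of [n] = Fin n, as Data.Fin.Subset (Vec of inside/outside).

Edge : ∀ {n} → Subset n → Subset n → Set
Edge x y = x ⊆ y × ∣ y ∣ ≡ suc ∣ x ∣

-- A chain is a nonempty list of subsets, listed from bottom to top.
Chain : ℕ → Set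
Chain n = List⁺ (Subset n)

Saturated : ∀ {n} → Chain n → Set
Saturated c = Linked Edge (toList c)

Symmetric : ∀ {n} → Chain n → Set
Symmetric {n} c = ∣ head c ∣ + ∣ last c ∣ ≡ n

width : ℕ → ℕ
width n = n C (n / 2)

record SCD (n : ℕ) : Set where
  field
    chains      : List (Chain n)
    count       : length chains ≡ width n
    saturated   : ∀ {c} → c ∈ chains → Saturated c
    symmetric   : ∀ {c} → c ∈ chains → Symmetric c
    covers      : ∀ (x : Subset n) → x ∈ concat (map toList chains)
    disjoint    : Unique (concat (map toList chains))

Uses : ∀ {n} → Chain n → Subset n → Subset n → Set
Uses c x y = x ∈ toList c × y ∈ toList c

EdgeDisjoint : ∀ {n} → SCD n → SCD n → Set
EdgeDisjoint {n} D E =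
  ¬ (∃[ x ] ∃[ y ] (Edge x y ×
       Any (λ c → Uses c x y) (SCD.chains D) ×
       Any (λ c → Uses c x y) (SCD.chains E)))

{-# OPTIONS --safe #-}
module Submission where

-- The product of a symmetric chain of Q_a with one of Q_b is a grid, which splits into
-- symmetric chains of Q_{a+b}. An edge used by the resulting decomposition moves in exactly
-- one of the two factors and projects to an edge used there, so the product of k pairwise
-- edge-disjoint decompositions of Q_a with k of Q_b consists of k pairwise edge-disjoint ones.
-- As every n ≥ 90 has the form 10 s + 11 r, five decompositions of Q_10 and of Q_11 suffice.
-- They are given explicitly (found by extending chains from the middle layers outwards with
-- randomised maximum flows) and checked by evaluation.

open import Defs
open import Algebra.Properties.CommutativeSemigroup using (interchange; x∙yz≈y∙xz)
import Data.Bool as Bool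
open import Data.Bool using (Bool; true; false; _∧_)
open import Data.Bool.Properties using (∧-conicalˡ; ∧-conicalʳ)
open import Data.Char using (isSpace) renaming (toℕ to code)
open import Data.Fin using (Fin; zero; suc)
open import Data.Fin.Subset using (Subset; inside; outside; ⊥; ∣_∣; _⊆_)
open import Data.Fin.Subset.Properties using (_⊆?_; drop-∷-⊆; p⊆q⇒∣p∣≤∣q∣)
open import Data.List using (List; []; _∷_; _++_; _ʳ++_; map; concat; concatMap; length; take; drop; foldl; filter;
  wordsByᵇ; cartesianProductWith; initLast; _∷ʳ′_)
open import Data.List.Membership.Propositional using (_∈_; find; lose)
open import Data.List.Membership.Propositional.Properties
open import Data.List.Membership.Propositional.Properties.WithK using (unique∧set⇒bag)
open import Data.List.NonEmpty using (List⁺; _∷_; _∷⁺_; toList; head; last)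
open import Data.List.Properties
open import Data.List.Relation.Binary.BagAndSetEquality using (∼bag⇒↭)
open import Data.List.Relation.Binary.Disjoint.Propositional using (Disjoint)
open import Data.List.Relation.Binary.Permutation.Propositional as ↭
  using (_↭_; ↭-refl; ↭-sym; ↭-reflexive; module PermutationReasoning)
open import Data.List.Relation.Binary.Permutation.Propositional.Properties
  using (∈-resp-↭; ++⁺; ++⁺ˡ; ++⁺ʳ; ++-comm; ++↭ʳ++; shifts; ↭-length; ∷↭∷ʳ)
open import Data.List.Relation.Unary.All as All using (All; []; _∷_; all?)
import Data.List.Relation.Unary.All.Properties as All
open import Data.List.Relation.Unary.AllPairs using ([]; _∷_)
open import Data.List.Relation.Unary.Any using (Any; here; there)
open import Data.List.Relation.Unary.Linked as Linked using (Linked; linked?; []; [-]; _∷_)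
import Data.List.Relation.Unary.Linked.Properties as Linked
open import Data.List.Relation.Unary.Unique.Propositional using (Unique)
import Data.List.Relation.Unary.Unique.Propositional.Properties as Unique
open import Data.Nat using (ℕ; zero; suc; _+_; _*_; _∸_; _/_; _%_; _≤_; _<_; _≥_; s≤s; s≤s⁻¹; NonZero; _≟_)
open import Data.Nat.Combinatorics using (_C_; nCk+nC[k+1]≡[n+1]C[k+1])
open import Data.Nat.DivMod using (_mod_; m*n/n≡m; /-monoˡ-≤; m%n<n; m≡m%n+[m/n]*n)
open import Data.Nat.Properties hiding (_≟_)
open import Data.Product using (_×_; _,_; ∃; ∃₂; proj₁; proj₂)
open import Data.String using (String) renaming (toList to letters)
open import Data.Sum using (_⊎_; inj₁; inj₂)
open import Data.Vec as Vec using (Vec; []; _∷_; here; there) renaming (_++_ to _∙_)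
import Data.Vec.Properties as Vec
import Data.Vec.Membership.Propositional.Properties as Vec
import Data.Vec.Relation.Unary.All as Allᵛ
import Data.Vec.Relation.Unary.All.Properties as Allᵛ
open import Function using (_∘_; flip; mk⇔)
open import Relation.Binary.PropositionalEquality
  using (_≡_; _≢_; refl; sym; trans; cong; cong₂; subst; setoid; module ≡-Reasoning)
open import Relation.Nullary using (¬_; Dec; does; yes; no; contradiction)
open import Relation.Nullary.Decidable using (_×-dec_)

-- Two coprime dimensions are enough for their sums to reach every large n. The sums of tens and
-- elevens reach every n from (10 - 1)(11 - 1) = 90 on, while 89 is missed. The product is
-- controlled through one fact: the elements of the product decomposition are, up to order, all
-- concatenations of an element of the one factor with an element of the other. Covering, absence of
-- repetitions and the projection of used pairs are all read off from it. The explicit data have to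
-- be tested within type checking, and this shapes the second half. The five decompositions of Q_11
-- use 5 (2048 - 462) = 7930 edges altogether, too many to compare pair by pair. An edge of Q_n is
-- therefore encoded as a subset of a set with 2n elements, so that one recursive test, branching on
-- the first coordinate, detects repeated sets and repeated edges alike.

private variable
  A   : Set
  n k : ℕ

-- Chains as lists of sets

elements : List (Chain n) → List (Subset n)
elements cs = concat (map toList cs)

elements-++ : (cs ds : List (Chain n)) → elements (cs ++ ds) ≡ elements cs ++ elements ds
elements-++ cs ds = trans (cong concat (map-++ toList cs ds)) (sym (concat-++ (map toList cs) (map toList ds)))

-- `last` goes through the view `initLast`, which does not reduce along a cons. This version
-- recurses along the list, as the inductions on chains require.
top : A → List A → A
top x []       = x
top _ (x ∷ xs) = top x xs

last≡top : (x : A) (xs : List A) → last (x ∷ xs) ≡ top x xs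
last≡top x []       = refl
last≡top x (y ∷ ys) = trans last-∷ (last≡top y ys)
  where
  last-∷ : last (x ∷ y ∷ ys) ≡ last (y ∷ ys)
  last-∷ with initLast ys
  ... | []      = refl
  ... | zs ∷ʳ′ z = refl

sizes-above : {x : Subset n} {xs : List (Subset n)} →
  Linked Edge (x ∷ xs) → All (λ y → ∣ x ∣ < ∣ y ∣) xs
sizes-above [-]                  = []
sizes-above ((_ , ∣y∣≡1+∣x∣) ∷ l) =
  ≤-reflexive (sym ∣y∣≡1+∣x∣) ∷
  All.map (<-trans (≤-reflexive (sym ∣y∣≡1+∣x∣))) (sizes-above l)

-- Layers of the cube and the number of chains

-- The recursion is Pascal's rule: sets with and without the first element. Its length thus follows
-- the recursion of `_C_`, and the two parts are disjoint because their sets differ in the first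
-- coordinate.
layer : ∀ n → ℕ → List (Subset n)
layer zero    zero    = [] ∷ []
layer zero    (suc k) = []
layer (suc n) zero    = map (outside ∷_) (layer n zero)
layer (suc n) (suc k) = map (inside ∷_) (layer n k) ++ map (outside ∷_) (layer n (suc k))

length-layer : ∀ n k → length (layer n k) ≡ n C k
length-layer zero    zero    = refl
length-layer zero    (suc k) = refl
length-layer (suc n) zero    =
  trans (length-map _ (layer n zero)) (length-layer n zero)
length-layer (suc n) (suc k) = begin
  length (map (inside ∷_) (layer n k) ++ map (outside ∷_) (layer n (suc k)))
    ≡⟨ length-++ (map (inside ∷_) (layer n k)) ⟩
  length (map (inside ∷_) (layer n k)) + length (map (outside ∷_) (layer n (suc k)))
    ≡⟨ cong₂ _+_ (length-map _ (layer n k)) (length-map _ (layer n (suc k))) ⟩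
  length (layer n k) + length (layer n (suc k))
    ≡⟨ cong₂ _+_ (length-layer n k) (length-layer n (suc k)) ⟩
  n C k + n C suc k
    ≡⟨ nCk+nC[k+1]≡[n+1]C[k+1] n k ⟩
  suc n C suc k ∎
  where open ≡-Reasoning

∈-layer⁺ : (x : Subset n) → x ∈ layer n ∣ x ∣
∈-layer⁺ []          = here refl
∈-layer⁺ (true ∷ x)  = ∈-++⁺ˡ (∈-map⁺ (inside ∷_) (∈-layer⁺ x))
∈-layer⁺ (false ∷ x) = outside∈ (∈-layer⁺ x)
  where
  outside∈ : ∀ {k} {x : Subset n} → x ∈ layer n k → (outside ∷ x) ∈ layer (suc n) k
  outside∈ {k = zero}  = ∈-map⁺ (outside ∷_)
  outside∈ {n} {suc k} = ∈-++⁺ʳ (map (inside ∷_) (layer n k)) ∘ ∈-map⁺ (outside ∷_)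

∈-layer⁻ : ∀ n k {x : Subset n} → x ∈ layer n k → ∣ x ∣ ≡ k
∈-layer⁻ zero    zero    (here refl) = refl
∈-layer⁻ (suc n) zero    x∈ with ∈-map⁻ (outside ∷_) x∈
... | y , y∈ , refl = ∈-layer⁻ n zero y∈
∈-layer⁻ (suc n) (suc k) x∈ with ∈-++⁻ (map (inside ∷_) (layer n k)) x∈
... | inj₁ x∈ˡ with y , y∈ , refl ← ∈-map⁻ (inside ∷_) x∈ˡ = cong suc (∈-layer⁻ n k y∈)
... | inj₂ x∈ʳ with y , y∈ , refl ← ∈-map⁻ (outside ∷_) x∈ʳ = ∈-layer⁻ n (suc k) y∈

layer-unique : ∀ n k → Unique (layer n k)
layer-unique zero    zero    = [] ∷ []
layer-unique zero    (suc k) = []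
layer-unique (suc n) zero    = Unique.map⁺ Vec.∷-injectiveʳ (layer-unique n zero)
layer-unique (suc n) (suc k) = Unique.++⁺
  (Unique.map⁺ Vec.∷-injectiveʳ (layer-unique n k))
  (Unique.map⁺ Vec.∷-injectiveʳ (layer-unique n (suc k)))
  λ (x∈ , x∈′) → clash (∈-map⁻ (inside ∷_) x∈) (∈-map⁻ (outside ∷_) x∈′)
  where
  clash : ∀ {x : Subset (suc n)} {xs ys} → ∃ (λ y → y ∈ xs × x ≡ inside ∷ y) →
          ¬ ∃ (λ y → y ∈ ys × x ≡ outside ∷ y)
  clash (_ , _ , refl) (_ , _ , ())

ofSize : ℕ → List (Subset n) → List (Subset n)
ofSize k = filter (λ x → ∣ x ∣ ≟ k)

-- Sizes grow by exactly one along the chain, so m is neither skipped nor repeated. As long as the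
-- current size is not m it is smaller, and the next size is still at most m. Once it equals m, all
-- later sizes exceed m.
chain-meets-once : ∀ {m} (x : Subset n) xs → Linked Edge (x ∷ xs) →
  ∣ x ∣ ≤ m → m ≤ ∣ top x xs ∣ → length (ofSize m (x ∷ xs)) ≡ 1
chain-meets-once {m = m} x xs l x≤m m≤t with ∣ x ∣ ≟ m
... | yes refl = cong length (trans (filter-accept size? refl) (cong (x ∷_) (filter-none size?
                   (All.map (λ x<y y≡m → <⇒≢ x<y (sym y≡m)) (sizes-above l)))))
  where size? = λ y → ∣ y ∣ ≟ m
chain-meets-once x [] l x≤m m≤t | no x≢m = contradiction (≤-antisym x≤m m≤t) x≢m
chain-meets-once {m = m} x (y ∷ ys) (e ∷ l) x≤m m≤t | no x≢m =
  trans (cong length (filter-reject (λ z → ∣ z ∣ ≟ m) {x = x} {xs = y ∷ ys} x≢m))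
        (chain-meets-once y ys l (subst (_≤ m) (sym (proj₂ e)) (≤∧≢⇒< x≤m x≢m)) m≤t)

double : ∀ m → m * 2 ≡ m + m
double m = trans (*-comm m 2) (cong (m +_) (+-identityʳ m))

top-≥ : (x : Subset n) (xs : List (Subset n)) → Linked Edge (x ∷ xs) → ∣ x ∣ ≤ ∣ top x xs ∣
top-≥ x []       _       = ≤-refl
top-≥ x (y ∷ ys) (e ∷ l) = ≤-trans (≤-trans (n≤1+n _) (≤-reflexive (sym (proj₂ e)))) (top-≥ y ys l)

-- With x the minimum and t the maximum, symmetry and ∣ x ∣ ≤ ∣ t ∣ give 2 ∣ x ∣ ≤ n ≤ 2 ∣ t ∣.
-- Halving with rounding is monotone and undoes the doubling exactly, whatever the parity of n.
middle-once : (c : Chain n) → Saturated c → Symmetric c → length (ofSize (n / 2) (toList c)) ≡ 1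
middle-once {n} (x ∷ xs) sat sym′ = chain-meets-once x xs sat x≤m m≤t
  where
  open ≤-Reasoning
  t = top x xs
  x≤t : ∣ x ∣ ≤ ∣ t ∣
  x≤t = top-≥ x xs sat
  x+t≡n : ∣ x ∣ + ∣ t ∣ ≡ n
  x+t≡n = subst (λ z → ∣ x ∣ + ∣ z ∣ ≡ n) (last≡top x xs) sym′
  x≤m : ∣ x ∣ ≤ n / 2
  x≤m = begin
    ∣ x ∣         ≡⟨ m*n/n≡m ∣ x ∣ 2 ⟨
    ∣ x ∣ * 2 / 2 ≤⟨ /-monoˡ-≤ 2 (begin
      ∣ x ∣ * 2     ≡⟨ double ∣ x ∣ ⟩
      ∣ x ∣ + ∣ x ∣ ≤⟨ +-monoʳ-≤ ∣ x ∣ x≤t ⟩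
      ∣ x ∣ + ∣ t ∣ ≡⟨ x+t≡n ⟩
      n             ∎) ⟩
    n / 2 ∎
  m≤t : n / 2 ≤ ∣ t ∣
  m≤t = begin
    n / 2         ≤⟨ /-monoˡ-≤ 2 (begin
      n             ≡⟨ x+t≡n ⟨
      ∣ x ∣ + ∣ t ∣ ≤⟨ +-monoˡ-≤ ∣ t ∣ x≤t ⟩
      ∣ t ∣ + ∣ t ∣ ≡⟨ double ∣ t ∣ ⟨
      ∣ t ∣ * 2     ∎) ⟩
    ∣ t ∣ * 2 / 2 ≡⟨ m*n/n≡m ∣ t ∣ 2 ⟩
    ∣ t ∣ ∎

length-middle : (cs : List (Chain n)) → All Saturated cs → All Symmetric cs →
  length (ofSize (n / 2) (elements cs)) ≡ length cs
length-middle []       []         []         = refl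
length-middle {n} (c ∷ cs) (sat ∷ sats) (sym′ ∷ syms) = begin
  length (ofSize (n / 2) (toList c ++ elements cs))
    ≡⟨ cong length (filter-++ (λ x → ∣ x ∣ ≟ n / 2) (toList c) (elements cs)) ⟩
  length (ofSize (n / 2) (toList c) ++ ofSize (n / 2) (elements cs))
    ≡⟨ length-++ (ofSize (n / 2) (toList c)) ⟩
  length (ofSize (n / 2) (toList c)) + length (ofSize (n / 2) (elements cs))
    ≡⟨ cong₂ _+_ (middle-once c sat sym′) (length-middle cs sats syms) ⟩
  suc (length cs) ∎
  where open ≡-Reasoning

-- The field count is automatic, as each chain meets the middle layer exactly once.
mkSCD : (cs : List (Chain n)) → All Saturated cs → All Symmetric cs →
  (∀ x → x ∈ elements cs) → Unique (elements cs) → SCD n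
mkSCD {n} cs sats syms covers unique = record
  { chains    = cs
  ; count     = begin
      length cs                             ≡⟨ length-middle cs sats syms ⟨
      length (ofSize (n / 2) (elements cs)) ≡⟨ ↭-length middle↭layer ⟩
      length (layer n (n / 2))              ≡⟨ length-layer n (n / 2) ⟩
      width n                               ∎
  ; saturated = All.lookup sats
  ; symmetric = All.lookup syms
  ; covers    = covers
  ; disjoint  = unique
  }
  where
  open ≡-Reasoning
  size? = λ (x : Subset n) → ∣ x ∣ ≟ n / 2
  middle↭layer : ofSize (n / 2) (elements cs) ↭ layer n (n / 2)
  -- Two lists without repetitions and with the same members are permutations of each other, so
  -- their lengths agree.
  middle↭layer = ∼bag⇒↭ (unique∧set⇒bag (Unique.filter⁺ size? unique) (layer-unique n (n / 2))
    (λ {x} → mk⇔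
      (λ x∈ → subst (λ k → x ∈ layer n k) (proj₂ (∈-filter⁻ size? {xs = elements cs} x∈)) (∈-layer⁺ x))
      (λ x∈ → ∈-filter⁺ size? (covers x) (∈-layer⁻ n (n / 2) x∈))))

-- Inclusions and edges in a product of two cubes

⊆-++⁺ : {x x′ : Subset n} {y y′ : Subset k} → x ⊆ x′ → y ⊆ y′ → (x ∙ y) ⊆ (x′ ∙ y′)
⊆-++⁺ {x = []}    {[]}     p q m         = q m
⊆-++⁺ {x = _ ∷ _} {_ ∷ _}  p q here with here ← p here = here
⊆-++⁺ {x = _ ∷ _} {_ ∷ _}  p q (there m) = there (⊆-++⁺ (drop-∷-⊆ p) q m)

⊆-++⁻ˡ : (x x′ : Subset n) {y y′ : Subset k} → (x ∙ y) ⊆ (x′ ∙ y′) → x ⊆ x′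
⊆-++⁻ˡ (_ ∷ _) (_ ∷ _)  p here with here ← p here = here
⊆-++⁻ˡ (_ ∷ x) (_ ∷ x′) p (there m) = there (⊆-++⁻ˡ x x′ (drop-∷-⊆ p) m)

⊆-++⁻ʳ : (x x′ : Subset n) {y y′ : Subset k} → (x ∙ y) ⊆ (x′ ∙ y′) → y ⊆ y′
⊆-++⁻ʳ []      []       p = p
⊆-++⁻ʳ (_ ∷ x) (_ ∷ x′) p = ⊆-++⁻ʳ x x′ (drop-∷-⊆ p)

∣++∣ : (x : Subset n) (y : Subset k) → ∣ x ∙ y ∣ ≡ ∣ x ∣ + ∣ y ∣
∣++∣ []          y = refl
∣++∣ (true ∷ x)  y = cong suc (∣++∣ x y)
∣++∣ (false ∷ x) y = ∣++∣ x y

⊆∧∣∣≡⇒≡ : (x y : Subset n) → x ⊆ y → ∣ x ∣ ≡ ∣ y ∣ → x ≡ y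
⊆∧∣∣≡⇒≡ []          []          p e = refl
⊆∧∣∣≡⇒≡ (true ∷ x)  (true ∷ y)  p e = cong (inside ∷_) (⊆∧∣∣≡⇒≡ x y (drop-∷-⊆ p) (suc-injective e))
⊆∧∣∣≡⇒≡ (false ∷ x) (false ∷ y) p e = cong (outside ∷_) (⊆∧∣∣≡⇒≡ x y (drop-∷-⊆ p) e)
⊆∧∣∣≡⇒≡ (false ∷ x) (true ∷ y)  p e = contradiction e (<⇒≢ (s≤s (p⊆q⇒∣p∣≤∣q∣ (drop-∷-⊆ p))))
⊆∧∣∣≡⇒≡ (true ∷ x)  (false ∷ y) p e with () ← p here

edge-++ˡ : {x x′ : Subset n} (y : Subset k) → Edge x x′ → Edge (x ∙ y) (x′ ∙ y)
edge-++ˡ {x = x} {x′} y (p , e) = ⊆-++⁺ p (λ m → m) ,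
  trans (∣++∣ x′ y) (trans (cong (_+ ∣ y ∣) e) (cong suc (sym (∣++∣ x y))))

edge-++ʳ : (x : Subset n) {y y′ : Subset k} → Edge y y′ → Edge (x ∙ y) (x ∙ y′)
edge-++ʳ x {y} {y′} (p , e) = ⊆-++⁺ {x = x} (λ m → m) p ,
  trans (∣++∣ x y′) (trans (cong (∣ x ∣ +_) e) (trans (+-suc ∣ x ∣ ∣ y ∣) (cong suc (sym (∣++∣ x y)))))

-- The total size grows by one and neither part can shrink. If the first parts have equal size, the
-- second part carries the whole growth. Otherwise the first part grows by at least one, and there
-- is no room for more.
edge-++⁻ : (x x′ : Subset n) {y y′ : Subset k} → Edge (x ∙ y) (x′ ∙ y′) →
  Edge x x′ ⊎ Edge y y′
edge-++⁻ x x′ {y} {y′} (p , e) with ∣ x ∣ ≟ ∣ x′ ∣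
... | yes ∣x∣≡∣x′∣ = inj₂ (⊆-++⁻ʳ x x′ p , +-cancelˡ-≡ ∣ x′ ∣ ∣ y′ ∣ (suc ∣ y ∣) (begin
    ∣ x′ ∣ + ∣ y′ ∣    ≡⟨ ∣++∣ x′ y′ ⟨
    ∣ x′ ∙ y′ ∣        ≡⟨ e ⟩
    suc ∣ x ∙ y ∣      ≡⟨ cong suc (∣++∣ x y) ⟩
    suc (∣ x ∣ + ∣ y ∣) ≡⟨ +-suc ∣ x ∣ ∣ y ∣ ⟨
    ∣ x ∣ + suc ∣ y ∣  ≡⟨ cong (_+ suc ∣ y ∣) ∣x∣≡∣x′∣ ⟩
    ∣ x′ ∣ + suc ∣ y ∣ ∎))
  where open ≡-Reasoning
... | no ∣x∣≢∣x′∣ = inj₁ (x⊆x′ , ≤-antisym (+-cancelʳ-≤ ∣ y′ ∣ _ _ (begin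
    ∣ x′ ∣ + ∣ y′ ∣     ≡⟨ ∣++∣ x′ y′ ⟨
    ∣ x′ ∙ y′ ∣         ≡⟨ e ⟩
    suc ∣ x ∙ y ∣       ≡⟨ cong suc (∣++∣ x y) ⟩
    suc ∣ x ∣ + ∣ y ∣   ≤⟨ +-monoʳ-≤ (suc ∣ x ∣) (p⊆q⇒∣p∣≤∣q∣ (⊆-++⁻ʳ x x′ p)) ⟩
    suc ∣ x ∣ + ∣ y′ ∣  ∎)) (≤∧≢⇒< (p⊆q⇒∣p∣≤∣q∣ x⊆x′) ∣x∣≢∣x′∣))
  where
  open ≤-Reasoning
  x⊆x′ = ⊆-++⁻ˡ x x′ p

-- Splitting a grid into symmetric chains

-- The nonempty accumulator makes the result a chain by its type. Starting from a singleton this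
-- reverses a chain; starting from an ascending piece it glues a descending one, turned round,
-- underneath.
revOnto : List⁺ A → List A → List⁺ A
revOnto c []       = c
revOnto c (x ∷ xs) = revOnto (x ∷⁺ c) xs

reverse⁺ : List⁺ A → List⁺ A
reverse⁺ (x ∷ xs) = revOnto (x ∷ []) xs

toList-revOnto : (c : List⁺ A) (xs : List A) → toList (revOnto c xs) ≡ xs ʳ++ toList c
toList-revOnto c []       = refl
toList-revOnto c (x ∷ xs) = toList-revOnto (x ∷⁺ c) xs

head-revOnto : (c : List⁺ A) (xs : List A) → head (revOnto c xs) ≡ top (head c) xs
head-revOnto c []       = refl
head-revOnto c (x ∷ xs) = head-revOnto (x ∷⁺ c) xs

last-revOnto : (c : List⁺ A) (xs : List A) → last (revOnto c xs) ≡ last c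
last-revOnto c []       = refl
last-revOnto c@(y ∷ ys) (x ∷ xs) = trans (last-revOnto (x ∷⁺ c) xs)
  (trans (last≡top x (y ∷ ys)) (sym (last≡top y ys)))

-- Two relations are needed because reversal is used both ways: from `flip Edge` to `Edge` when a
-- hook is built, and from `Edge` to `flip Edge` when the first factor is turned downwards.
linked-revOnto : {R S : A → A → Set} → (∀ {x y} → R x y → S y x) →
  (c : List⁺ A) (xs : List A) →
  Linked S (toList c) → Linked R (head c ∷ xs) → Linked S (toList (revOnto c xs))
linked-revOnto f c []       lc _       = lc
linked-revOnto f c (x ∷ xs) lc (r ∷ l) = linked-revOnto f (x ∷⁺ c) xs (f r ∷ lc) l

top-map : {B : Set} (f : A → B) (x : A) (xs : List A) → top (f x) (map f xs) ≡ f (top x xs)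
top-map f x []       = refl
top-map f x (y ∷ ys) = top-map f y ys

-- The first argument lists its chain downwards, the second one upwards. Each chain of the
-- result climbs the first factor at a fixed element of the second, and then the second
-- factor at the top reached; what remains is the grid without its last column and first row.
hooks : List (Subset n) → List (Subset k) → List (Chain (n + k))
hooks (x ∷ xs) (y ∷ ys) = revOnto ((x ∙ y) ∷ map (x ∙_) ys) (map (_∙ y) xs) ∷ hooks xs ys
hooks _        _        = []

hooks-saturated : (xs : List (Subset n)) (ys : List (Subset k)) →
  Linked (flip Edge) xs → Linked Edge ys → All Saturated (hooks xs ys)
hooks-saturated []       ys       _ _ = []
hooks-saturated (x ∷ xs) []       _ _ = []
hooks-saturated (x ∷ xs) (y ∷ ys) l m =
  linked-revOnto {S = Edge} (λ e → e) ((x ∙ y) ∷ map (x ∙_) ys) (map (_∙ y) xs)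
    (Linked.map⁺ (Linked.map (edge-++ʳ x) m)) (Linked.map⁺ (Linked.map (edge-++ˡ y) l))
  ∷ hooks-saturated xs ys (Linked.tail l) (Linked.tail m)

-- The next hook starts one step higher in the second factor and ends one step lower in the first,
-- so the sum of its end sizes is unchanged. This sum is the induction hypothesis because the
-- shortened lists are no longer symmetric chains of their own cubes.
hooks-symmetric : ∀ {N} x xs y ys → Linked (flip Edge) (x ∷ xs) → Linked Edge (y ∷ ys) →
  ∣ top x xs ∣ + ∣ y ∣ + (∣ x ∣ + ∣ top y ys ∣) ≡ N →
  All (λ c → ∣ head c ∣ + ∣ last c ∣ ≡ N) (hooks {n} {k} (x ∷ xs) (y ∷ ys))
hooks-symmetric {N = N} x xs y ys l m eq = ends ∷ rest xs ys l m eq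
  where
  open ≡-Reasoning
  c = (x ∙ y) ∷ map (x ∙_) ys
  ends : ∣ head (revOnto c (map (_∙ y) xs)) ∣ + ∣ last (revOnto c (map (_∙ y) xs)) ∣ ≡ N
  ends = begin
    ∣ head (revOnto c (map (_∙ y) xs)) ∣ + ∣ last (revOnto c (map (_∙ y) xs)) ∣
      ≡⟨ cong₂ (λ u v → ∣ u ∣ + ∣ v ∣)
           (trans (head-revOnto c (map (_∙ y) xs)) (top-map (_∙ y) x xs))
           (trans (last-revOnto c (map (_∙ y) xs)) (trans (last≡top (x ∙ y) (map (x ∙_) ys)) (top-map (x ∙_) y ys))) ⟩
    ∣ top x xs ∙ y ∣ + ∣ x ∙ top y ys ∣
      ≡⟨ cong₂ _+_ (∣++∣ (top x xs) y) (∣++∣ x (top y ys)) ⟩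
    ∣ top x xs ∣ + ∣ y ∣ + (∣ x ∣ + ∣ top y ys ∣)
      ≡⟨ eq ⟩
    N ∎
  rest : ∀ xs ys → Linked (flip Edge) (x ∷ xs) → Linked Edge (y ∷ ys) →
    ∣ top x xs ∣ + ∣ y ∣ + (∣ x ∣ + ∣ top y ys ∣) ≡ N →
    All (λ c → ∣ head c ∣ + ∣ last c ∣ ≡ N) (hooks xs ys)
  rest []        ys        _       _       _  = []
  rest (x′ ∷ xs) []        _       _       _  = []
  rest (x′ ∷ xs) (y′ ∷ ys) (e ∷ l) (f ∷ m) eq = hooks-symmetric x′ xs y′ ys l m (begin
    ∣ t ∣ + ∣ y′ ∣ + (∣ x′ ∣ + ∣ u ∣)     ≡⟨ cong (λ s → ∣ t ∣ + s + (∣ x′ ∣ + ∣ u ∣)) (proj₂ f) ⟩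
    ∣ t ∣ + suc ∣ y ∣ + (∣ x′ ∣ + ∣ u ∣)  ≡⟨ cong (_+ (∣ x′ ∣ + ∣ u ∣)) (+-suc ∣ t ∣ ∣ y ∣) ⟩
    suc (∣ t ∣ + ∣ y ∣ + (∣ x′ ∣ + ∣ u ∣)) ≡⟨ +-suc (∣ t ∣ + ∣ y ∣) (∣ x′ ∣ + ∣ u ∣) ⟨
    ∣ t ∣ + ∣ y ∣ + (suc ∣ x′ ∣ + ∣ u ∣)  ≡⟨ cong (λ s → ∣ t ∣ + ∣ y ∣ + (s + ∣ u ∣)) (proj₂ e) ⟨
    ∣ t ∣ + ∣ y ∣ + (∣ x ∣ + ∣ u ∣)       ≡⟨ eq ⟩
    N                                     ∎)
    where
    t = top x′ xs
    u = top y′ ys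

-- Products of lists up to permutation

infixl 7 _⊠_
-- The reference list for the elements of a product. Covering and uniqueness both transfer along
-- permutations, so the order in which hooks visit the grid can be forgotten.
_⊠_ : List (Subset n) → List (Subset k) → List (Subset (n + k))
_⊠_ = cartesianProductWith _∙_

-- A hook removes one line of the grid in each direction. Unfolding `⊠` yields only lines with a
-- fixed first component; this supplies the line with a fixed second component.
⊠-∷ʳ : (xs : List (Subset n)) (y : Subset k) (ys : List (Subset k)) →
  xs ⊠ (y ∷ ys) ↭ map (_∙ y) xs ++ xs ⊠ ys
⊠-∷ʳ []       y ys = ↭-refl
⊠-∷ʳ (x ∷ xs) y ys = ↭.prep (x ∙ y) (begin
  map (x ∙_) ys ++ xs ⊠ (y ∷ ys)              ↭⟨ ++⁺ˡ (map (x ∙_) ys) (⊠-∷ʳ xs y ys) ⟩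
  map (x ∙_) ys ++ (map (_∙ y) xs ++ xs ⊠ ys) ↭⟨ shifts (map (x ∙_) ys) (map (_∙ y) xs) ⟩
  map (_∙ y) xs ++ (map (x ∙_) ys ++ xs ⊠ ys) ∎)
  where open PermutationReasoning

⊠-++ʳ : (xs : List (Subset n)) (ys zs : List (Subset k)) →
  xs ⊠ (ys ++ zs) ↭ xs ⊠ ys ++ xs ⊠ zs
⊠-++ʳ xs []       zs = ↭-reflexive (cong (_++ xs ⊠ zs) (sym (cartesianProductWith-zeroʳ _∙_ xs)))
⊠-++ʳ xs (y ∷ ys) zs = begin
  xs ⊠ (y ∷ ys ++ zs)                    ↭⟨ ⊠-∷ʳ xs y (ys ++ zs) ⟩
  map (_∙ y) xs ++ xs ⊠ (ys ++ zs)       ↭⟨ ++⁺ˡ (map (_∙ y) xs) (⊠-++ʳ xs ys zs) ⟩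
  map (_∙ y) xs ++ (xs ⊠ ys ++ xs ⊠ zs)  ≡⟨ ++-assoc (map (_∙ y) xs) (xs ⊠ ys) (xs ⊠ zs) ⟨
  (map (_∙ y) xs ++ xs ⊠ ys) ++ xs ⊠ zs  ↭⟨ ++⁺ʳ (xs ⊠ zs) (⊠-∷ʳ xs y ys) ⟨
  xs ⊠ (y ∷ ys) ++ xs ⊠ zs               ∎
  where open PermutationReasoning

⊠-resp-↭ : {xs xs′ : List (Subset n)} (ys : List (Subset k)) → xs ↭ xs′ → xs ⊠ ys ↭ xs′ ⊠ ys
⊠-resp-↭ ys ↭.refl         = ↭-refl
⊠-resp-↭ ys (↭.prep x p)   = ++⁺ˡ (map (x ∙_) ys) (⊠-resp-↭ ys p)
⊠-resp-↭ ys (↭.swap {xs} x y p) = ↭.trans (shifts (map (x ∙_) ys) (map (y ∙_) ys))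
  (++⁺ˡ (map (y ∙_) ys) (++⁺ˡ (map (x ∙_) ys) (⊠-resp-↭ ys p)))
⊠-resp-↭ ys (↭.trans p q)  = ↭.trans (⊠-resp-↭ ys p) (⊠-resp-↭ ys q)

elements-hooks : (xs : List (Subset n)) (ys : List (Subset k)) → elements (hooks xs ys) ↭ xs ⊠ ys
elements-hooks []       ys       = ↭-refl
elements-hooks (x ∷ xs) []       = ↭-reflexive (sym (cartesianProductWith-zeroʳ _∙_ xs))
elements-hooks (x ∷ xs) (y ∷ ys) = begin
  toList (revOnto c (map (_∙ y) xs)) ++ elements (hooks xs ys)
    ≡⟨ cong (_++ elements (hooks xs ys)) (toList-revOnto c (map (_∙ y) xs)) ⟩
  (map (_∙ y) xs ʳ++ toList c) ++ elements (hooks xs ys)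
    ↭⟨ ++⁺ (++↭ʳ++ (map (_∙ y) xs) (toList c)) (↭-sym (elements-hooks xs ys)) ⟨
  (map (_∙ y) xs ++ toList c) ++ xs ⊠ ys
    ↭⟨ ++⁺ʳ (xs ⊠ ys) (++-comm (map (_∙ y) xs) (toList c)) ⟩
  (toList c ++ map (_∙ y) xs) ++ xs ⊠ ys
    ≡⟨ ++-assoc (toList c) (map (_∙ y) xs) (xs ⊠ ys) ⟩
  toList c ++ (map (_∙ y) xs ++ xs ⊠ ys)
    ↭⟨ ++⁺ˡ (toList c) (⊠-∷ʳ xs y ys) ⟨
  toList c ++ xs ⊠ (y ∷ ys) ∎
  where
  open PermutationReasoning
  c = (x ∙ y) ∷ map (x ∙_) ys

reverse⁺-↭ : (c : List⁺ A) → toList (reverse⁺ c) ↭ toList c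
reverse⁺-↭ (x ∷ xs) = begin
  toList (revOnto (x ∷ []) xs) ≡⟨ toList-revOnto (x ∷ []) xs ⟩
  xs ʳ++ (x ∷ [])              ↭⟨ ++↭ʳ++ xs (x ∷ []) ⟨
  xs ++ (x ∷ [])               ↭⟨ ↭-sym (∷↭∷ʳ x xs) ⟩
  x ∷ xs                       ∎
  where open PermutationReasoning

infixl 7 _⊗ᶜ_

-- Turning the first chain downwards puts its maximum at the head of the list, so the grid left
-- after a hook is obtained by dropping both heads.
_⊗ᶜ_ : Chain n → Chain k → List (Chain (n + k))
c ⊗ᶜ d = hooks (toList (reverse⁺ c)) (toList d)

elements-⊗ᶜ : (c : Chain n) (d : Chain k) → elements (c ⊗ᶜ d) ↭ toList c ⊠ toList d
elements-⊗ᶜ c d = ↭.trans (elements-hooks (toList (reverse⁺ c)) (toList d))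
  (⊠-resp-↭ (toList d) (reverse⁺-↭ c))

⊗ᶜ-saturated : (c : Chain n) (d : Chain k) → Saturated c → Saturated d → All Saturated (c ⊗ᶜ d)
⊗ᶜ-saturated (x ∷ xs) d l m = hooks-saturated (toList (reverse⁺ (x ∷ xs))) (toList d)
  (linked-revOnto (λ e → e) (x ∷ []) xs [-] l) m

⊗ᶜ-symmetric : (c : Chain n) (d : Chain k) → Saturated c → Saturated d →
  Symmetric c → Symmetric d → All Symmetric (c ⊗ᶜ d)
⊗ᶜ-symmetric {n} {k} c@(x ∷ xs) d@(y ∷ ys) l m symc symd
  -- The reversed chain is abstracted together with its three known properties: it descends, its
  -- head is the maximum of `c`, and its last element is the minimum `x`.
  with reverse⁺ c | linked-revOnto {S = flip Edge} (λ e → e) (x ∷ []) xs [-] l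
     | head-revOnto (x ∷ []) xs | last-revOnto (x ∷ []) xs
... | x′ ∷ xs′ | l′ | refl | lst = hooks-symmetric x′ xs′ y ys l′ m (begin
  ∣ top x′ xs′ ∣ + ∣ y ∣ + (∣ x′ ∣ + ∣ top y ys ∣)
    ≡⟨ cong (λ z → ∣ z ∣ + ∣ y ∣ + (∣ x′ ∣ + ∣ top y ys ∣)) (trans (sym (last≡top x′ xs′)) lst) ⟩
  ∣ x ∣ + ∣ y ∣ + (∣ x′ ∣ + ∣ top y ys ∣)
    ≡⟨ interchange +-commutativeSemigroup (∣ x ∣) (∣ y ∣) (∣ x′ ∣) (∣ top y ys ∣) ⟩
  (∣ x ∣ + ∣ x′ ∣) + (∣ y ∣ + ∣ top y ys ∣)
    ≡⟨ cong₂ (λ u v → (∣ x ∣ + ∣ u ∣) + (∣ y ∣ + ∣ v ∣)) (sym (last≡top x xs)) (sym (last≡top y ys)) ⟩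
  (∣ x ∣ + ∣ last c ∣) + (∣ y ∣ + ∣ last d ∣)
    ≡⟨ cong₂ _+_ symc symd ⟩
  n + k ∎)
  where
  open ≡-Reasoning

-- Products of decompositions and their edges

products : List (Chain n) → List (Chain k) → List (Chain (n + k))
products cs ds = concatMap (λ c → concatMap (c ⊗ᶜ_) ds) cs

elements-products : (cs : List (Chain n)) (ds : List (Chain k)) →
  elements (products cs ds) ↭ elements cs ⊠ elements ds
elements-products []       ds = ↭-refl
elements-products (c ∷ cs) ds = begin
  elements (concatMap (c ⊗ᶜ_) ds ++ products cs ds)
    ≡⟨ elements-++ (concatMap (c ⊗ᶜ_) ds) (products cs ds) ⟩
  elements (concatMap (c ⊗ᶜ_) ds) ++ elements (products cs ds)
    ↭⟨ ++⁺ (row ds) (elements-products cs ds) ⟩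
  toList c ⊠ elements ds ++ elements cs ⊠ elements ds
    ≡⟨ cartesianProductWith-distribʳ-++ _∙_ (toList c) (elements cs) (elements ds) ⟨
  (toList c ++ elements cs) ⊠ elements ds ∎
  where
  open PermutationReasoning
  row : ∀ ds → elements (concatMap (c ⊗ᶜ_) ds) ↭ toList c ⊠ elements ds
  row []       = ↭-reflexive (sym (cartesianProductWith-zeroʳ _∙_ (toList c)))
  row (d ∷ ds) = begin
    elements (c ⊗ᶜ d ++ concatMap (c ⊗ᶜ_) ds)
      ≡⟨ elements-++ (c ⊗ᶜ d) (concatMap (c ⊗ᶜ_) ds) ⟩
    elements (c ⊗ᶜ d) ++ elements (concatMap (c ⊗ᶜ_) ds)
      ↭⟨ ++⁺ (elements-⊗ᶜ c d) (row ds) ⟩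
    toList c ⊠ toList d ++ toList c ⊠ elements ds
      ↭⟨ ⊠-++ʳ (toList c) (toList d) (elements ds) ⟨
    toList c ⊠ (toList d ++ elements ds) ∎

∈-products⁻ : (cs : List (Chain n)) (ds : List (Chain k)) {e : Chain (n + k)} → e ∈ products cs ds →
  ∃₂ λ c d → c ∈ cs × d ∈ ds × e ∈ c ⊗ᶜ d
∈-products⁻ cs ds e∈
  with c , c∈ , e∈c ← find (∈-concatMap⁻ (λ c → concatMap (c ⊗ᶜ_) ds) {xs = cs} e∈)
  with d , d∈ , e∈cd ← find (∈-concatMap⁻ (c ⊗ᶜ_) {xs = ds} e∈c)
  = c , d , c∈ , d∈ , e∈cd

-- The number of hooks of a pair depends on the lengths of both chains, but no summation over pairs
-- is needed: `mkSCD` obtains the count from the middle layer.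
_⊗_ : SCD n → SCD k → SCD (n + k)
_⊗_ {n} {k} 𝒞 𝒟 = mkSCD (products 𝒞.chains 𝒟.chains)
  (All.tabulate λ e∈ → let c , d , c∈ , d∈ , e∈cd = ∈-products⁻ 𝒞.chains 𝒟.chains e∈ in
    All.lookup (⊗ᶜ-saturated c d (𝒞.saturated c∈) (𝒟.saturated d∈)) e∈cd)
  (All.tabulate λ e∈ → let c , d , c∈ , d∈ , e∈cd = ∈-products⁻ 𝒞.chains 𝒟.chains e∈ in
    All.lookup (⊗ᶜ-symmetric c d (𝒞.saturated c∈) (𝒟.saturated d∈) (𝒞.symmetric c∈) (𝒟.symmetric d∈)) e∈cd)
  covers
  (Unique-resp-↭ (↭-sym perm)
    (Unique.cartesianProductWith⁺ _∙_ (λ {w} {x} → Vec.++-injective w x) 𝒞.disjoint 𝒟.disjoint))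
  where
  module 𝒞 = SCD 𝒞
  module 𝒟 = SCD 𝒟
  open import Data.List.Relation.Binary.Permutation.Setoid.Properties (setoid (Subset (n + k)))
    using () renaming (Unique-resp-↭ to Unique-respˢ-↭)
  perm : elements (products 𝒞.chains 𝒟.chains) ↭ elements 𝒞.chains ⊠ elements 𝒟.chains
  perm = elements-products 𝒞.chains 𝒟.chains
  Unique-resp-↭ : {xs ys : List (Subset (n + k))} → xs ↭ ys → Unique xs → Unique ys
  Unique-resp-↭ p = Unique-respˢ-↭ (↭.↭⇒↭ₛ p)
  covers : ∀ z → z ∈ elements (products 𝒞.chains 𝒟.chains)
  covers z with x , y , refl ← Vec.splitAt n z =
    ∈-resp-↭ (↭-sym perm) (∈-cartesianProductWith⁺ _∙_ (𝒞.covers x) (𝒟.covers y))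

-- By `elements-⊗ᶜ` every element of a hook lies in the grid of `c` and `d`, and a concatenation
-- determines its two parts.
⊗ᶜ-uses : {c : Chain n} {d : Chain k} {e : Chain (n + k)} {x : Subset n} {y : Subset k} →
  e ∈ c ⊗ᶜ d → (x ∙ y) ∈ toList e → x ∈ toList c × y ∈ toList d
⊗ᶜ-uses {c = c} {d} {x = x} e∈ xy∈
  with x′ , y′ , x′∈ , y′∈ , eq ← ∈-cartesianProductWith⁻ _∙_ (toList c) (toList d)
         (∈-resp-↭ (elements-⊗ᶜ c d) (∈-concat⁺′ xy∈ (∈-map⁺ toList e∈)))
  with refl , refl ← Vec.++-injective x x′ eq
  = x′∈ , y′∈

UsedBy : SCD n → Subset n → Subset n → Set
UsedBy 𝒞 x y = Any (λ c → Uses c x y) (SCD.chains 𝒞)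

-- Both sets lie on one hook `e`, and this hook comes from one pair `c`, `d`. Hence the same `c`
-- contains both first parts and the same `d` both second parts.
⊗-uses : (𝒞 : SCD n) (𝒟 : SCD k) {x x′ : Subset n} {y y′ : Subset k} →
  UsedBy (𝒞 ⊗ 𝒟) (x ∙ y) (x′ ∙ y′) → UsedBy 𝒞 x x′ × UsedBy 𝒟 y y′
⊗-uses 𝒞 𝒟 used
  with e , e∈ , xy∈ , xy′∈ ← find used
  with c , d , c∈ , d∈ , e∈cd ← ∈-products⁻ (SCD.chains 𝒞) (SCD.chains 𝒟) e∈
  with x∈  , y∈  ← ⊗ᶜ-uses {c = c} {d} e∈cd xy∈
  with x′∈ , y′∈ ← ⊗ᶜ-uses {c = c} {d} e∈cd xy′∈
  = lose c∈ (x∈ , x′∈) , lose d∈ (y∈ , y′∈)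

⊗-edgeDisjoint : (𝒞 𝒞′ : SCD n) (𝒟 𝒟′ : SCD k) →
  EdgeDisjoint 𝒞 𝒞′ → EdgeDisjoint 𝒟 𝒟′ → EdgeDisjoint (𝒞 ⊗ 𝒟) (𝒞′ ⊗ 𝒟′)
⊗-edgeDisjoint {n} 𝒞 𝒞′ 𝒟 𝒟′ 𝒞𝒞′ 𝒟𝒟′ (u , v , edge , used , used′) =
  -- Passing the splittings as arguments lets `project` match them with `refl`, which turns `u` and
  -- `v` into concatenations in the edge and in both uses at once.
  project (Vec.splitAt n u) (Vec.splitAt n v) edge used used′
  where
  project : (∃₂ λ x y → u ≡ x ∙ y) → (∃₂ λ x′ y′ → v ≡ x′ ∙ y′) →
    Edge u v → UsedBy (𝒞 ⊗ 𝒟) u v → ¬ UsedBy (𝒞′ ⊗ 𝒟′) u v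
  project (x , y , refl) (x′ , y′ , refl) edge used used′ with edge-++⁻ x x′ edge
  ... | inj₁ e = 𝒞𝒞′ (x , x′ , e , proj₁ (⊗-uses 𝒞 𝒟 used) , proj₁ (⊗-uses 𝒞′ 𝒟′ used′))
  ... | inj₂ e = 𝒟𝒟′ (y , y′ , e , proj₂ (⊗-uses 𝒞 𝒟 used) , proj₂ (⊗-uses 𝒞′ 𝒟′ used′))

-- Families of pairwise edge-disjoint decompositions

Family : ℕ → ℕ → Set
Family k n = ∃ λ (𝒟 : Fin k → SCD n) → ∀ i j → i ≢ j → EdgeDisjoint (𝒟 i) (𝒟 j)

-- Q_0 has a single element and no edge, so its only decomposition is edge-disjoint from itself and
-- can be repeated. It serves as the empty product in `family-*`.
family-0 : Family k 0
family-0 = (λ _ → mkSCD (([] ∷ []) ∷ []) ([-] ∷ []) (refl ∷ []) (λ { [] → here refl }) ([] ∷ [])) ,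
  λ { _ _ _ ([] , [] , (_ , ()) , _) }

family-+ : ∀ {m} → Family k m → Family k n → Family k (m + n)
family-+ (𝒞 , disjC) (𝒟 , disjD) = (λ i → 𝒞 i ⊗ 𝒟 i) ,
  λ i j i≢j → ⊗-edgeDisjoint (𝒞 i) (𝒞 j) (𝒟 i) (𝒟 j) (disjC i j i≢j) (disjD i j i≢j)

family-* : ∀ m → Family k n → Family k (m * n)
family-* zero    F = family-0
family-* (suc m) F = family-+ F (family-* m F)

-- Testing an explicit decomposition

-- One level of a binary radix sort. Repeated over all coordinates it passes each listed set down at
-- most n levels, in place of comparing every set with every other.
split : Bool → List (Subset (suc n)) → List (Subset n)
split b     []                 = []
split true  ((true  ∷ x) ∷ xs) = x ∷ split true xs
split true  ((false ∷ x) ∷ xs) = split true xs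
split false ((true  ∷ x) ∷ xs) = split false xs
split false ((false ∷ x) ∷ xs) = x ∷ split false xs

∈-split⁺ : ∀ b {x : Subset n} {xs} → (b ∷ x) ∈ xs → x ∈ split b xs
∈-split⁺ true                           (here refl) = here refl
∈-split⁺ false                          (here refl) = here refl
∈-split⁺ true  {xs = (true ∷ _) ∷ _}    (there x∈)  = there (∈-split⁺ true x∈)
∈-split⁺ true  {xs = (false ∷ _) ∷ _}   (there x∈)  = ∈-split⁺ true x∈
∈-split⁺ false {xs = (true ∷ _) ∷ _}    (there x∈)  = ∈-split⁺ false x∈
∈-split⁺ false {xs = (false ∷ _) ∷ _}   (there x∈)  = there (∈-split⁺ false x∈)

∈-split⁻ : ∀ b {x : Subset n} xs → x ∈ split b xs → (b ∷ x) ∈ xs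
∈-split⁻ true  ((true ∷ _) ∷ xs)  (here refl) = here refl
∈-split⁻ true  ((true ∷ _) ∷ xs)  (there x∈)  = there (∈-split⁻ true xs x∈)
∈-split⁻ true  ((false ∷ _) ∷ xs) x∈          = there (∈-split⁻ true xs x∈)
∈-split⁻ false ((true ∷ _) ∷ xs)  x∈          = there (∈-split⁻ false xs x∈)
∈-split⁻ false ((false ∷ _) ∷ xs) (here refl) = here refl
∈-split⁻ false ((false ∷ _) ∷ xs) (there x∈)  = there (∈-split⁻ false xs x∈)

-- Sets with different first coordinates differ, so a repetition would occur inside one of the two
-- halves, where it survives the removal of that coordinate.
unique-split⁻ : (xs : List (Subset (suc n))) →
  Unique (split true xs) → Unique (split false xs) → Unique xs
unique-split⁻ []                 _           _           = []
unique-split⁻ ((true ∷ x) ∷ xs)  u@(_ ∷ uᵗ)  uᶠ          =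
  All.¬Any⇒All¬ xs (Unique.Unique[x∷xs]⇒x∉xs u ∘ ∈-split⁺ true) ∷ unique-split⁻ xs uᵗ uᶠ
unique-split⁻ ((false ∷ x) ∷ xs) uᵗ          u@(_ ∷ uᶠ)  =
  All.¬Any⇒All¬ xs (Unique.Unique[x∷xs]⇒x∉xs u ∘ ∈-split⁺ false) ∷ unique-split⁻ xs uᵗ uᶠ

coversᵇ : ∀ n → List (Subset n) → Bool
coversᵇ zero    []      = false
coversᵇ zero    (_ ∷ _) = true
coversᵇ (suc n) xs      = coversᵇ n (split true xs) ∧ coversᵇ n (split false xs)

coversᵇ-sound : ∀ n (xs : List (Subset n)) → coversᵇ n xs ≡ true → ∀ x → x ∈ xs
coversᵇ-sound zero    ([] ∷ _) _  []          = here refl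
coversᵇ-sound (suc n) xs       eq (true ∷ x)  =
  ∈-split⁻ true xs (coversᵇ-sound n (split true xs) (∧-conicalˡ _ _ eq) x)
coversᵇ-sound (suc n) xs       eq (false ∷ x) =
  ∈-split⁻ false xs (coversᵇ-sound n (split false xs) (∧-conicalʳ _ _ eq) x)

-- Stopping at [] keeps the recursion from visiting all 2 ^ n leaves.
uniqueᵇ : ∀ n → List (Subset n) → Bool
uniqueᵇ _       []            = true
uniqueᵇ zero    (_ ∷ [])      = true
uniqueᵇ zero    (_ ∷ _ ∷ _)   = false
uniqueᵇ (suc n) xs@(_ ∷ _)    = uniqueᵇ n (split true xs) ∧ uniqueᵇ n (split false xs)

uniqueᵇ-sound : ∀ n (xs : List (Subset n)) → uniqueᵇ n xs ≡ true → Unique xs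
uniqueᵇ-sound _       []         _  = []
uniqueᵇ-sound zero    (_ ∷ [])   _  = [] ∷ []
uniqueᵇ-sound (suc n) xs@(_ ∷ _) eq = unique-split⁻ xs
  (uniqueᵇ-sound n (split true xs) (∧-conicalˡ _ _ eq))
  (uniqueᵇ-sound n (split false xs) (∧-conicalʳ _ _ eq))

edge? : (x y : Subset n) → Dec (Edge x y)
edge? x y = (x ⊆? y) ×-dec (∣ y ∣ ≟ suc ∣ x ∣)

saturated? : (cs : List (Chain n)) → Dec (All Saturated cs)
saturated? = all? (λ c → linked? edge? (toList c))

symmetric? : (cs : List (Chain n)) → Dec (All Symmetric cs)
symmetric? {n} = all? (λ c → ∣ head c ∣ + ∣ last c ∣ ≟ n)

-- The test is Boolean so that evaluation concerns only the `does` parts of the decisions; the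
-- soundness lemmas turn the outcome into proofs.
scdᵇ : List (Chain n) → Bool
scdᵇ {n} cs = (does (saturated? cs) ∧ does (symmetric? cs))
  ∧ (coversᵇ n (elements cs) ∧ uniqueᵇ n (elements cs))

does-sound : {P : Set} (p? : Dec P) → does p? ≡ true → P
does-sound (yes p) _ = p

scdᵇ-sound : (cs : List (Chain n)) → scdᵇ cs ≡ true → SCD n
scdᵇ-sound {n} cs eq = mkSCD cs
  (does-sound (saturated? cs) (∧-conicalˡ _ _ (∧-conicalˡ _ _ eq)))
  (does-sound (symmetric? cs) (∧-conicalʳ (does (saturated? cs)) _ (∧-conicalˡ _ _ eq)))
  (coversᵇ-sound n (elements cs) (∧-conicalˡ _ _ (∧-conicalʳ check _ eq)))
  (uniqueᵇ-sound n (elements cs) (∧-conicalʳ (coversᵇ n (elements cs)) _ (∧-conicalʳ check _ eq)))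
  where check = does (saturated? cs) ∧ does (symmetric? cs)

-- Testing edge-disjointness

-- An edge is stored as the concatenation of its two ends, a subset of a set with n + n elements, so
-- that `uniqueᵇ` applies to lists of edges.
steps : List (Subset n) → List (Subset (n + n))
steps (x ∷ y ∷ zs) = (x ∙ y) ∷ steps (y ∷ zs)
steps _            = []

-- `Uses` asks only that both ends lie on the chain. Sizes increase strictly along it, by one at
-- each step, so two elements whose sizes differ by one must be neighbours in the right order.
∈-steps : {zs : List (Subset n)} {x y : Subset n} → Linked Edge zs →
  x ∈ zs → y ∈ zs → ∣ y ∣ ≡ suc ∣ x ∣ → (x ∙ y) ∈ steps zs
∈-steps _       (here refl) (here refl) e = contradiction (sym e) 1+n≢n
∈-steps (_ ∷ _) (here refl) (there (here refl)) e = here refl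
∈-steps (f ∷ l) (here refl) (there (there y∈)) e =
  contradiction (trans (proj₂ f) (sym e)) (<⇒≢ (All.lookup (sizes-above l) y∈))
∈-steps l (there x∈) (here refl) e =
  contradiction (<-trans (All.lookup (sizes-above l) x∈) (≤-reflexive (sym e))) (<-irrefl refl)
∈-steps (_ ∷ l) (there x∈@(here _)) (there y∈) e = there (∈-steps l x∈ y∈ e)
∈-steps (_ ∷ l) (there x∈@(there _)) (there y∈) e = there (∈-steps l x∈ y∈ e)

edges : List (Chain n) → List (Subset (n + n))
edges = concatMap (steps ∘ toList)

usedBy⇒∈-edges : (𝒞 : SCD n) {x y : Subset n} → Edge x y → UsedBy 𝒞 x y → (x ∙ y) ∈ edges (SCD.chains 𝒞)
usedBy⇒∈-edges 𝒞 (_ , e) used with c , c∈ , x∈ , y∈ ← find used =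
  ∈-concatMap⁺ (steps ∘ toList) (lose c∈ (∈-steps (SCD.saturated 𝒞 c∈) x∈ y∈ e))

unique-++⁻ : (xs : List A) {ys : List A} → Unique (xs ++ ys) → Disjoint xs ys × Unique ys
unique-++⁻ []       u = (λ ()) , u
unique-++⁻ (x ∷ xs) u@(_ ∷ u′) with disj , u″ ← unique-++⁻ xs u′ =
  (λ { (here refl , y∈) → Unique.Unique[x∷xs]⇒x∉xs u (∈-++⁺ʳ xs y∈)
     ; (there x∈ , y∈)  → disj (x∈ , y∈) }) , u″

-- It allows a single uniqueness test on all edge lists joined together to settle every pair of
-- decompositions. The joint test demands nothing extra, as no edge occurs twice within one
-- decomposition.
unique-concatMap⁻ : {B : Set} (f : A → List B) (as : Vec A k) → Unique (concatMap f (Vec.toList as)) →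
  ∀ i j → i ≢ j → Disjoint (f (Vec.lookup as i)) (f (Vec.lookup as j))
unique-concatMap⁻ f (a ∷ as) u zero    zero    i≢j _ = i≢j refl
unique-concatMap⁻ f (a ∷ as) u zero    (suc j) i≢j (x∈ , y∈) = proj₁ (unique-++⁻ (f a) u) (x∈ , ∈-rest j y∈)
  where
  ∈-rest : ∀ j {b} → b ∈ f (Vec.lookup as j) → b ∈ concatMap f (Vec.toList as)
  ∈-rest j b∈ = ∈-concatMap⁺ f (lose (Vec.∈-toList⁺ (Vec.∈-lookup j as)) b∈)
unique-concatMap⁻ f (a ∷ as) u (suc i) zero    i≢j (x∈ , y∈) =
  unique-concatMap⁻ f (a ∷ as) u zero (suc i) (λ ()) (y∈ , x∈)
unique-concatMap⁻ f (a ∷ as) u (suc i) (suc j) i≢j =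
  unique-concatMap⁻ f as (proj₂ (unique-++⁻ (f a) u)) i j (i≢j ∘ cong suc)

familyᵇ : Vec (List (Chain n)) k → Bool
familyᵇ {n} css = does (Allᵛ.all? (λ cs → scdᵇ cs Bool.≟ true) css) 
  ∧ uniqueᵇ (n + n) (concatMap edges (Vec.toList css))

familyᵇ-sound : (css : Vec (List (Chain n)) k) → familyᵇ css ≡ true → Family k n
familyᵇ-sound {n} css eq = D , λ i j i≢j (x , y , e , used , used′) →
  unique-concatMap⁻ edges css (uniqueᵇ-sound (n + n) _ (∧-conicalʳ (does (Allᵛ.all? _ css)) _ eq)) i j i≢j
    (usedBy⇒∈-edges (D i) e used , usedBy⇒∈-edges (D j) e used′)
  where
  D : Fin _ → SCD n
  -- The chains of `D i` reduce to `Vec.lookup css i`, so the edge lists that were tested are those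
  -- of `D i` by definition.
  D i = scdᵇ-sound (Vec.lookup css i)
    (Allᵛ.lookup⁺ (does-sound (Allᵛ.all? (λ cs → scdᵇ cs Bool.≟ true) css) (∧-conicalˡ _ _ eq)) i)

-- Encoding of chains by words

add : Subset n → Fin n → Subset n
add (_ ∷ x) zero    = inside ∷ x
add (b ∷ x) (suc i) = b ∷ add x i

climb : Subset n → List (Fin n) → Chain n
climb x []       = x ∷ []
climb x (i ∷ is) = x ∷⁺ climb (add x i) is

-- A word of length n ∸ k denotes a chain from a k-set to an (n ∸ k)-set: its first
-- k letters form the minimum, and the others are added one by one.
chain : List (Fin n) → Chain n
chain {n} w = climb (foldl add ⊥ (take (n ∸ length w) w)) (drop (n ∸ length w) w)

-- Letters are read modulo n, so that any n consecutive letters name the elements of Fin n.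
decode : .{{_ : NonZero n}} → List String → List (Chain n)
decode {n} = concatMap (map (chain ∘ map (λ c → code c mod n)) ∘ wordsByᵇ isSpace ∘ letters)

-- Explicit decompositions of Q_10 and Q_11

-- Each block is one decomposition, with words by decreasing length: 1, 9, 35, 75, 90 and 42 words
-- of 10 down to 5 letters, 252 in all. The number of words of length 10 - k is the increase from
-- layer k - 1 to layer k.
words-10 : Vec (List String) 5
words-10 =
  ( "egahdicfjb aebidcghj bhcfaidej cibdfagje dciabhjgf fahcgdebj ghdbcefia hfiecjgab idjgeafbh"
  ∷ "jdhfigceb abcjhfde acgedjhi adgjhifc aghbjfed ahedbgfi aifgejhb ajecdbgh bceihfag bdcgajie"
  ∷ "bejhicfg bfcgdije bgjfadhc bidjcehg bjdagifh cefjadig cfjahebg cgijbhaf chaejdfg cjegbiha"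
  ∷ "defgaihj dfbeicaj dgecfbaj dhbjeaic efaicgdb ehbdfcjg eihdacjf ejfbicdh fgcaidhb fibjhedg"
  ∷ "fjabcihd giebjfca gjdcbihf hibcjaef hjafbied ijhabegd abdegij abfhigc abgceji abhcgid"
  ∷ "abifejd abjegif acdbegh acedhbj acfedbj acihebd acjhdgi adegjbh adfbhei adhbjfe adihbjg"
  ∷ "adjhfcg aeijfhd afgbchd agiehcj agjecfi ahigjfb aijdbec bcgefai bcjfdhg bdecihf bdgecjf"
  ∷ "befgjca begafdi beidgjc bfgdeja bfhegca bfjdgca bgheaci bgijdhe bhjcgda bijhdfa cdejbhg"
  ∷ "cdfejig cdghief cdhbafe cdjfgae cegfhjb cehbjga ceigajd cfheagi cfiebaj cgheifb cgjbfia"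
  ∷ "chidjbf chjeidf cijdgaf dehjafg deigfcb dejifbg dfgjhei dfhagib dfiehac dfjaibc dgihebc"
  ∷ "dhifcgb efgjcdh efhgibd efibhag eghibad egjdcih ehjagdi eijcfah fghjeac fgichbj fgjcabh"
  ∷ "fhjbegd fijcadh ghijebf ghjbfid gijfach abcejh abcfej abcieg abdgfc abdigh abefhg abehcf"
  ∷ "abgife abgjch abhigj abhjeg abijec acdfge acdghb acdhif acdjfb aceijd acfibg acghed acgihf"
  ∷ "acgjih acijdb adefib adeicf adejfi adfgji adfihj adghbf adgihc aefghd aefhjb aefjbd aehifg"
  ∷ "afghjd afgjeb afhijc afijbg aghjcf agijeh bcdfhi bcdjha bcefdj bcejfh bcfijh bcghei bcgida"
  ∷ "bcijag bdejfh bdfhjg bdfiah bdgifj bdgjha bdhife begjhd behiad beijdh bfghdc bfgied bfhigd"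
  ∷ "bghidc cdehfa cdeigb cdfgij cdfhge cdfijb cdgiae cdhjef cehidf cfghbj cfhiae cfhjdg cghije"
  ∷ "cghjdi chijae defhgb defjga deghcj dfghie dfgiab dfijge dghjie dhijac efgicb efhjdi efijgh"
  ∷ "eghjca egijcf ehijad fghijc fhijcd abcdf abcdj abcgi abchi abdef abdej abdfj abegi abfgh"
  ∷ "abgij acdfh acdfi acdgj acefg adefh adegi adeij adgij afghi bcdeh bcdhi bcefh bcegi bceij"
  ∷ "bcfgi bcfhi bcfhj bcghi bdegh bdegj bdehi bdfij bfgij bghij cdefi cdeij cefhj cfghj cfgij"
  ∷ "deghj dehij efhij"
  ∷ []) ∷
  ( "fdecbghjai adebjgihc bfeijagdc cabhdifge djfhcaieb eafjhibcg gbeidhjfa hedigfbcj iecdfhjga"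
  ∷ "jiacfbdhg abhdecij afdghebj agebjcfd ahjedcgf aigdehfc ajbhcgie bcfagjdi bdieahfg beajhdfi"
  ∷ "bhdfcage bijehfga bjhedcif cdfgahij cedgbhaj cfibedha cgahfiej chdifbgj cidbjfea cjbiegaf"
  ∷ "dejghcia dgbhiacj dhigajbf digecjab efgbdica egcbiafh ejigfbdc fgdeijca fhcbijag fiedagjh"
  ∷ "fjhegcib ghecfabj gibdcejh gjhdcabf higacebd hjdefacb abdjifh abfdiej abgdhjf abigdfj"
  ∷ "acdfhie acebfid acfigbj achjidb aciefjd acjgbid adgehbi adhiefj adicfeg adjfhig aehcijd"
  ∷ "aeibfgd aejdgcb afgeicj afhgebj afidgcj afjhgbc aghjbed agjfdhe ahijdbe bcdhjfa bcedhig"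
  ∷ "bcgdjfh bchgaej bciedja bdehijf bdfgaec bdjfage behcaif beihgfc bejchfg bfgahdi bfhijgc"
  ∷ "bfigcha bfjigcd bghicje bgjdefh bhidjcg cdgaeib cdjeafg cefijha cehfjag cejfdhb cfgjiha"
  ∷ "cfjbaed cghifed cgiadbf cgjdefb chiadeg chjbiea cijfbea deghfca deijghf dfhceba dfijbhc"
  ∷ "dghcbje dgjfcha dijageh efhacbj efjgdhc egifbcj egjhbia ehigjca ehjcabd fghdjib fgihbae"
  ∷ "fgjhiae fhicebj fijhabg gijhacd hijcgdf abcdfe abcgdh abcihj abcjed abdicf abefjh abehfd"
  ∷ "abfhcg abfigj abfjhd abghie abgjfe abhiej abijce acdebi acdheg acdjgi acefgd acegbf acejfg"
  ∷ "acfgjd acfhib acfjdi adefgj adehfc adeijc adfhbi adghci adgjbc adhjge aefihc aeghif aegibd"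
  ∷ "aegjhf aehijg aeijgf afgihd afhibe afijdg agijcf bcdfga bcdjai bcefgh bcfghd bcgiah bcgjed"
  ∷ "bchidg bdefaj bdegac bdejcf bdfiej bdhjgi bdijea befhdj befjgh beghdj begjid bfghjd bfgjce"
  ∷ "bfhjca bghjcf bgijae bhijga cdehij cdfibg cdfjba cdgijb cdhjab cdijfg cefgdi cegihd cegjah"
  ∷ "cehibg ceijdf cfghja cfgiej cfhjia cghjeb cgijea defhib defjia dfgich dfhigb dgijba dhijfc"
  ∷ "efghbd efhigj efijhd ehijda fgijdb abcei abcfi abdhi abdhj abefg abegh abeij abfij abhij"
  ∷ "acdef acdei acdij acegh acegi aceij acfhj acghj adefj adfhi aefgj aefij afgij bcefh bcefj"
  ∷ "bcegh bcgij bdefj bdfgh bdfgi bdfgj bdfhi bdfhj befhi befhj cdegh cdehj cdfgh cdghi cdhij"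
  ∷ "cefgj cehij dghij"
  ∷ []) ∷
  ( "bcdieghjfa abidejfhc chjgbifae dehcajbig ejhifgdab fiachjedg gchbdifaj hagfbcied icebjadfg"
  ∷ "jfdcagbhe acegjbdi adcefihg aejfdghc afcjbgei agijdbhc aijhgdeb ajgbihef bdfcaijg befhidga"
  ∷ "bfhcjgea bgfecjid bheadjgc biegcfhj bjadefhc cdjgahfi cehgdabf cfdhjbei cjabdefg dfiajegc"
  ∷ "dgiabcef dhfjgcib dicfgbeh djaecgih efhdbgja egfidabj ehaibfdc eifhajgc fgjbheid fhjgcied"
  ∷ "ghjeaicb gicheadb gjecdhfb hicfjbda hjibadfg ijchefba abcfhje abdcgfh abegifc abfgecd"
  ∷ "abgicjh abhfdci acgjfid achbidg acibdeh adeigbh adfehji adgbjef adhfjbg adijceh aefgcih"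
  ∷ "aegijbd aeicgbj afgched afhebcd afjdbch ahifgbd ahjgfeb bceaihj bcfeadi bcgfaid bchegaf"
  ∷ "bcijdha bcjeghd bdeijgf bdgfhji bdhieaj bdifcej bdjiacg beghfad bejafic bficahe bfjagic"
  ∷ "bghaeif bgichej bgjheac bhifajc bhjafgi bijgehd cdefhgi cdgfhbe cdhjgbf cefajig cegdafi"
  ∷ "cejigbd cfgejha cfhajgb cfigahj cfjgbde cgjidfb defjhci degjfca deifcgj dejcfah dfgihaj"
  ∷ "dghaefi dgjhabc dhiefcb dhjigbc dijchag efjcida eghacjd egicdhj ehibcjd eijbfha fghicda"
  ∷ "fgibjea fhijdac fijbdeh ghibace gijdfab abcgjd abdech abdfeh abdhcg abefic abeijh abfidj"
  ∷ "abhidf abijfc acdfij acdgif acdhfe acdieg acdjhf acehfi acejbf acghij acgijd achijb achjgb"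
  ∷ "acijeg adegbh adehig adfgbh adgjeh adhije adhjbc aefidh aegjbf aehjci aeijdg afgibd afgjih"
  ∷ "afhjec afijeg aghidb bcdeji bcdgfe bcdhif bcdjge bcegad bcfjid bcgjif bchifg bchjae bdefch"
  ∷ "bdeghi bdehcg bdejhf bdfhig bdfjec bdghje bdgief bdgjfi bdhjie befida befjci begjfd behjcd"
  ∷ "bfghie bfhjdi cdeihb cdghaf cdgibj cdhiag cefhbi cefigh cehiad cehjgi cfgheb cfhjeb cfijge"
  ∷ "defgba deghjf degihj dehjif deijch dfghaj dfgjab dfhiac dfijch dghicj efghai efgjac efhjba"
  ∷ "efijdg eghifd egijdc fgijhd ghijbf abceh abcgh abcij abdgh abehj abghj acdfg acefi acfij"
  ∷ "adefg adehj adfgi aefgi aeghi aehij afhij bcdeg bcdfh bcdfj bcdhj bcefi bcfgh bcfgi bchij"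
  ∷ "bdegj bdfgi bdghi bdgij befgi beghi behij bfhij cdefg cdehj cdfgj cdfhi cefhi cghij defgh"
  ∷ "efghj efgij eghij"
  ∷ []) ∷
  ( "geiacfbjhd afecibhjd bdagefhci cdhfbjiga dafjgchei ecbghdjia fcedibgjh hbjgacdef igabjcedf"
  ∷ "jedhbgaif abgfjcid acidhjfg aeihdbcg agcifjeh ahcdjeib aidgcjbh ajifhdbe bcgaidhf begfahci"
  ∷ "bfidjgae bgieajhc biacjfed bjeiafhg cgfhabji chbaejgf cihjdegf cjgefadb deafcjbh dfgbicae"
  ∷ "dgahfcbj dhgjbfae dihcgbef djcaifge efigahbd ehjbgfcd eidcbafh fghedaci fhbdgiej fichdjea"
  ∷ "fjeicgbh ghcadeij gjibhdfa hijdbacf hjgfaide ijdfehbc abcdhef abecgih abfedih abhejfd"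
  ∷ "abjcfdg acdgfbe acehdif acfbdhj acjigeh adhejif adjgife aegjdib aehgjbf aejhfgd afgjche"
  ∷ "afhdigc afihedg afjeidc aghibde agjihbd ahibcfj ahjicgf bcdeaji bcfhged bcifhda bcjheig"
  ∷ "bdejgac bdfjcia bdgceai bdhcgfj bdihcej bdjcegi befdjic behfjdc beicajh bfgcjhi bfjgiha"
  ∷ "bghciaj bgjecfd bhigfcd bijfegh cdeajig cdfajhe cdgifeh cdijbgf cegahbd cehigbf ceiahgf"
  ∷ "cejbifh cfhjbea cfjdheg cgifbah chjabde cijehgf defibhc degfcji dehgajc dfhgcij dficage"
  ∷ "dfjeabi dgijhcb dgjeifb dhjaigc efgajdb efhjiac eghjfdb egjihdb ehifdgj eijhbad fgideba"
  ∷ "fgjebac fhibdag fhjigea fijgeab ghieajd abdehf abdfji abdhfg abdihc abdjhg abeghd abeihg"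
  ∷ "abejcg abfhjc abficd abfjih abghfj abgjdf abhjic abijdg acejhg acfgbe acfhed acfije acfjeh"
  ∷ "acgjdb achifd adegfc adeifc adejbh adfgie adfibg adhige adijeb aefhgc aefibh aeijhc afghic"
  ∷ "afgijb afhjci aghjdf bcdfea bcdiaj bcefih bcehfa bcfjed bcgije bcgjhe bchiea bcijfg bdegfc"
  ∷ "bdehgf bdeihg bdghac bdgiae bdgjch bdhjfa bdijge befiga befjac beghij behifj bfghei bfgiah"
  ∷ "bfhjic bhijcg cdegja cdehbf cdejig cdfgjb cdghei cdgjhe cdhjbi cefgbi cefhgd cefiha cefjhi"
  ∷ "ceghjf cegibd cehjdb cfgjhd cfijde cghiad cghjad cgijfd defhci degiac dehijb deijbc dfgjbe"
  ∷ "dfhijb dfhjae dghifj fghiec ghijcf abcdg abcdj abcef abcfh abcgh abcgj abdei abdfg abefh"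
  ∷ "abegj abfhi acdeg acdei acdfh acefg acegj aceij adefh adfij aegij bcdfg bcdfi bcdgi bdefh"
  ∷ "bdegi bdghi begij bfghj cdefj cdegi cdehi cdgij cefgi cegij cfghi cfhij defgj defhj deghi"
  ∷ "deghj dfghj dfgij"
  ∷ []) ∷
  ( "ijbchdeafg acfgebjhi bjgcdafeh cgjhiabde diaebgfhc eiagdjcfb fhgadbjic gajhiefdc hidafebjg"
  ∷ "jgfdebihc abedfcgh adjbcfie aehbgfic afbcjhgd ahbgdije aicfdbhj ajfghcie bcaifegd bdjgahef"
  ∷ "becfjghi bfgidhjc bgdaijef bhgdeaci bifhecdg cdeijbga cegjhdbf cfbidjga chiefdab cigejdfb"
  ∷ "cjiahfbe degijbhc dfhiejgc dgfcbhai dhcgjfea djgacfih efchdjai egjfhbai ehfbcjda ejchbaig"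
  ∷ "fgijbahc fihacgde fjbehicd ghadjceb gijeacfb hjedciag abdfgih abgjehi abihfdj abjfegd"
  ∷ "acdighj aceibdj acgdbej achgbfe acjegdf adehcfb adfiejh adgifhe adhcbjg aefhdgj aegdchf"
  ∷ "aejgfid afgdcib afhbeic afijcgb agihedj ahicgbf ahjcefi aijgfdh bcdaigj bcghjae bchiaeg"
  ∷ "bcigfed bcjdiah bdegica bdfhajc bdhaieg bdicgfh befagij begjdhf behidfj beifadc bejdifa"
  ∷ "bfhgcie bgihjcd bhijegc bhjfaei cdfjebi cdgeiah cdihbae cdjhifg cehagfj ceijabg cfgbedj"
  ∷ "cfhdiaj cfidejh cfjiebg cghfdaj chjifgb defbhag dehfjba deibfgh dejfbac dfibhcj dfjbiag"
  ∷ "dghfbec dgichfe dhjbaec dijeahb efghcij efiagdc efjacbh eghdicb egihcjd ehiacfg eijfacb"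
  ∷ "fhjcgbd fijdace ghicbda ghjifbe hijecag abcehg abcgfd abchji abcjgf abdijh abegdj abeigh"
  ∷ "abejdi abfgic abfije abgihf abhjgi abijhf acdeij acdfeg acdjeh acefbh acegih acfhbd acfjge"
  ∷ "acgibe acgjhe adefjh adejhg adfhcj adfjce adhjci adijhf aefgdb aeghfj aehjif aeijbg afgice"
  ∷ "afhjdg ahijfg bcdefi bcdfjg bcdgha bcdhea bcegja bcehid bceigj bcejda bcfhde bcfjhi bchjde"
  ∷ "bdehji bdfgja bdgijf bdhige bdijhg befgih beghjc begihc behjai beijch bfgjei bfijca bghjdc"
  ∷ "bgijcd cdefgh cdehgb cdejgb cdgjih cdijag cefgid cefiad cefjgi ceghbf cfgijb cfgjde cfhiba"
  ∷ "cgijab defghj defigh degjaf dehica dfgijc dfhjbc dghijf dghjfb dgijah dhijeg efgijd efhijc"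
  ∷ "efhjcg eghjif fghiae fghjba fhijbd abcde abcdf abceg abcej abcij abdeh abdfi abdfj abehi"
  ∷ "abfgh abfgj abgij acdgh acdhi acefh acfgh acfhj adegh adehi adfgj adghi aefhi aefhj aeghj"
  ∷ "bcdeg bcdei bcefi bcfgj bdefg befgh befij begij bfghi cdfgi cdfhj cdfij cfghi defij deghj"
  ∷ "dfghi dfhij efghi"
  ∷ []) ∷
  []

-- Here the counts are 1, 10, 44, 110, 165 and 132 for 11 down to 6 letters, 462 in all. As 11 is
-- odd, the shortest chains have two elements, of sizes 5 and 6.
words-11 : Vec (List String) 5
words-11 =
  ( "idkfehgcajb adcfhjbgie bkagjiedfh ckgfihejdb dhifaekjcb ekagfchdbi fhadgcjikb gfbhecijka"
  ∷ "hgfcdekbja jchkidegab kjbifecdag abigcdjkf acfkijegd aeckdigfb afkeijgbh aghejckbd"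
  ∷ "ahkcjbdfi aigebhkdj ajkgecbid akidbecjh bcjdifeag bdgefahjc beakjifhd bfdeigahk bghiajfce"
  ∷ "bhajicdkg bicdkegjh bjhicdega cdjegakfh cebhjfdak cfeaikbdh cghjfikab chibakdeg ciegdjkfb"
  ∷ "degcfahib dfehgjibk dgciahkbf djhicefba dkfgbcajh efbjakcdg egabhjfkd ehfidcbgk eifdcjahg"
  ∷ "ejkchifdb fibejhgad fjgicahek fkiabghec gikbdfhaj gjkiacfbe gkhdfcbji hiegfcjdb hjegikdfa"
  ∷ "hkbgfacje ijeacbhfk ikbahjgce abcfgekh abdiegjc abfhdikc abgdekjc abjkiche acgjebhf"
  ∷ "achbfekd acikdjef acjibgeh ackdgfib adejhicg adfekchi adgcbfek adhbjief adigfjhb adjkcbeh"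
  ∷ "adkeijhg aefjkcgb aehfdcbg aeikcbgh aejkdfbh afghkedj afigbhec afjbkich agjedfhi agkhidjf"
  ∷ "ahifkdcg ahjdifcb aijdkhbf bcdkhgji bcfheika bcgfhaik bchgdajk bckjhefa bdeikfha bdhekigf"
  ∷ "bdiheacj bdjhgiek bdkifjag beghidaj behicgkd beikjcaf bejdhgkc bekjfgcd bfhkjaig bfjdcegi"
  ∷ "bfkigedj bgifjkeh bgjfdkhe bgkfjhad bhiafced bijaeghk cdeagbik cdfbgjae cdhjageb cdifakbj"
  ∷ "cdkhjaie cegbfdia cehjdfag cejbdkfh cekbdhij cfgdkebi cfhaekjg cfibgkjh cfjgbida cfkdijah"
  ∷ "cgihbjad cgjbehfd chkfabdg cijkegfb cikbghfe cjkfibdg dehckgja deihckfb dejihbka dekfjibh"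
  ∷ "dfgajbke dfhkcjag dfiakejb dfjcgaik dghbkeca dgihfcba dgjhkica dgkicfbh dhkabfge dijkgabh"
  ∷ "djkhibgf efgcjdia efjcbaig efkihjag eghdaicb egibfcak egjidfab egkfbadi ehkcgadi eikgacjd"
  ∷ "fgikeach fgkadeij fhikdgae fhjcegdk fhkgcebj fijcdghk fjkehadc ghijbfdc ghjabdek gijachek"
  ∷ "hijecafk hikgjceb hjkeibfc ijkhfdcb abcdkfe abcehjd abcghid abcifkh abcjkfh abckghe"
  ∷ "abdecjg abdfeih abdjfkh abdkeji abefijd abehfdk abeikhc abejgkf abfghec abfijhe abfkgjc"
  ∷ "abghdfc abgjcki abhkgic acdhkeb acdihfg acdjfbe acegibh acehkij aceihfk acejkdf acfgjed"
  ∷ "acfigbd acfjbge acghdeb acgikbf acgkedf achikde achjgbk acjkfdb adegkih adehcjk adeigcf"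
  ∷ "adfjkih adfkhgc adghjei adgjbkc adgkhbj adhigfb aefghjk aefigbk aehigfk aehjkdg aehkijg"
  ∷ "afgjibc afhjikc afhkbei afijegb afjkigb aghijkc agikfhj ahijegf ahikdbe ahjkgcf aijkegd"
  ∷ "bcdegih bcdgjhe bcdhfkj bcefdhk bceikgj bcfjhga bcfkhjg bcgidkj bcgkfei bchjafi bchkidj"
  ∷ "bcijkgh bdekfgh bdfgaij bdfhjea bdfiakg bdfkaei bdgiake bdgjkif bdgkcai bdhkiga bdijkac"
  ∷ "bdjkeic befgajd befhdgj befkcdi begjifc begkcjh behjkfa behkcaj beijhak bfhidkc bfhjadi"
  ∷ "bfijdeh bfjkcdg bghjfda bgijadh bgjkeha bhikgfj bhjkaed cdefaib cdeiahf cdekgba cdfhekj"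
  ∷ "cdghebf cdgjaih cdgkhja cdhifba cdijabf cdikhfg cdjkfga cefhgaj cefikjd cefkdia ceghidf"
  ∷ "cegjiad cegkfjd cehikbj ceijdab ceikgfd cfgihbj cfhiakg cfikbhj cghkadb cgijbdh cgikjda"
  ∷ "cgjkedb chijgeb chikgea defgahi defjbkg degibjc degjfbi degkbji dehjfai dehkgab deikcgh"
  ∷ "dejkhbc dfghjcb dfgiehb dfgjkeh dfhjkei dfijhcb dfjkbhi dgijche dgjkafi dhikgcb efghjbk"
  ∷ "efgicja efgjkhi efhjbac efhkdbj efijcbh eghkbfa egjkdaf ehikgbf eijkgbh fghiace fghjkdc"
  ∷ "fgjkicd fhijgkd fhjkadg fijkdge ghjkcfe abcdfh abcdhe abcdif abcdjg abcefd abcegh abceid"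
  ∷ "abcejk abcekd abcfkg abchkd abcikd abdehk abdejg abdgkf abdhic abdijf abdjkh abefki abegkc"
  ∷ "abehic abehjd abehkg abfgjh abgike acdejf acdfgi acdfkh acefgi acefjh acefkb aceghi acehjk"
  ∷ "acfghk acfgki acfhjg acfije acghik acgjkd achijd acijke adefig adefjb adehik adehkf adeijb"
  ∷ "adfhjg adfijc adgijh adgikc adhjkg aefgjk aefhib aefhji aefhki aeghki aegijd afghji afgjkh"
  ∷ "ahijkc bcdehj bcdeif bcdfig bcdfki bcdhie bcdhja bcdjkh bcefia bceghk bcegij bceijh bcejkf"
  ∷ "bcfhij bcfija bcghjk bcghkf bcgjkf bdegha bdegjc bdeijc bdfghc bdfgih bdfhkg bdghia bdgijf"
  ∷ "bdhijf bdhjkg befgjc befhid befhkc befikc beghji begikd behikf bfghie bfhijk bfhika bghjka"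
  ∷ "bgijkh bhijkc cdefjk cdejkh cdfgie cdfhjb cdghib cdghje cdgjkb cdijkb cefhij cefhki cefjkh"
  ∷ "ceghjk cfgjka cfhija cfhikj cfhjka defgki defija deghik deghjk degikj dehikj deijkc dfgijh"
  ∷ "dfgika dghije efghkd efgijh efhijd efijkg eghjka fghike"
  ∷ []) ∷
  ( "abghfjidkec bhkjcaefdg ceabjgdfik dkjieafcbh ejachgdkbi fagkchijde gedjhbifck hjagkecifb"
  ∷ "ikagjhdbcf jfhibecadg kcfiebgdah acjfgibeh adhjbckgf aeijbfhgk agdbijehc ahfegkcbj"
  ∷ "aidfbgkch ajgfhecdk akdgfhije bcadhigek bdfickjah bejafhgdi bfiakedgh bgicjahfd bikjefagc"
  ∷ "bjgkifdac bkgejahci cdehfgabk cfhkgdije cgehkjdib chajfdgbe cikjghbfd cjkgbiedf debfcahki"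
  ∷ "dfacjegkb dgkjebcai dhgefkabj dijfehgac djaechbki efhcigakd ehkfabdji eikhfcbdj ekdhcaifj"
  ∷ "fgceibhad fhgbkjeid fiejhkcba fkeghicbd ghbkeijad gieakdchj gjdcbkhef gkedfjbai hijkgbfac"
  ∷ "hkcebfaig ijbcefkgh jkigdeafc abdjckig abegjdfi abfdcgji abhckgfi abihkegc abjfdckg"
  ∷ "abkhedjg acdjhkfb acfeghbj acgfbkei aciejfbd ackbjige adecifgb aefgkibh aeghkdij aehidcbk"
  ∷ "aekbcidg afiebdjh afjkdgeh afkdcghi aghdbkei agifkdce agkbedfc ahidfbjc ahkigcjd aijfkbdh"
  ∷ "ajkdicfg bcdjhfae bcefhgdi bcfjghei bcgaifhd bchikeaj bciajdek bcjaghde bckhgjfd bdgkaceh"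
  ∷ "bdhjkeif bdicaegj bdjkafgh bdkcefhg befkjcag begiakdj behkidaj beicfdak bekcfgjh bfgkaehj"
  ∷ "bfhaeikd bfjkideg bfkcadhi bhijdefc bhjafkgc bjkafgic cdfjegkh cdgfbekj cdhfjegb cdiagfje"
  ∷ "cdjigbfk cdkijfha cefkhjga cehiajdb ceidhjka cejfkahd cekdfgha cfihjbkd cfjkdaeb cghabdki"
  ∷ "cgidbhja cgjhdiae cgkhjabi chidbkaj chjfkgie cijhkbaf defcihkj dehbifac deibcgjf dejbcfki"
  ∷ "dfgbkach dfhbecjk dficjahe dfjhiaek dfkhbijg dgiaehfc dhibgfcj dhjekcbi dhkiecbg dikegcja"
  ∷ "efgbkhdi efjkicab eghfbdai egjchbik ehibajgc ehjkcaif eijgfcha ejkbafdi fgibchkd fgjcdieh"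
  ∷ "fgkdhiej fhiegjak fhkadeig fijkcged fikbdahg fjkdehgb ghicekdf ghjdaifc ghkfjadc gijcedhb"
  ∷ "gikebjdh gjkeifac hikfabje hjkdgcib abcfjik abdeghc abdhfje abdijhk abdkhce abefdkc"
  ∷ "abehjgc abeicjg abfgjch abfkeci abgijef abgjkdi abijhfc abikejg acdgekh acdhijb acdkejb"
  ∷ "aceghdi acehfjb acekfgj acfhdei acfidbk acfkjbg acgiefk acgjdbk acgkbid achibej achkieg"
  ∷ "acijfkg acikbhf acjkdgf adefijc adeghjf adehkjc adeibhg adekgfc adfgeik adfhjkb adfjehc"
  ∷ "adgjkic adhkicg adijehg adikehj aefjikh aefkdjh aegjfdi aegkcbj aehjdbg aehkcbg aeikhfc"
  ∷ "aejkgih afghikb afhibgd afhjekb afikedc aghibck aghkdjc agijecf agjkfch ahijfec ahjkibe"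
  ∷ "aijkbgh bcdehif bcdfhai bcdgeki bcdhgej bcegkhj bcehifa bcejfhk bcfgead bcfhikd bcfikag"
  ∷ "bcghfda bcgjhdf bcgkdfi bchjigf bcikjfg bcjkfhd bdegiaf bdekaij bdfjihg bdfkjeh bdghjfk"
  ∷ "bdgifca bdgjahk bdhkecg bdijcef bdikjhc befhkig befikgj befjdac beghcia begjhkd behjicd"
  ∷ "beijdah beikcdf bfgjeac bfhikje bfhjegi bfhkcdg bfijadc bghieaf bghjaid bgijfda bgikhad"
  ∷ "bhikjec cdegjbf cdejkfh cdfkgjb cdghife cdgkjib cdhjibf cdhkgbi cdjkhfg cefiabg cegibak"
  ∷ "cegkdja cehjfid ceijkbd ceikdaj cejkabi cfghija cfgiahd cfgkbhe cfijgbe cgikebh chikfad"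
  ∷ "chjkafb defgcib defhkca defigbh defjgik defkbhi degijac dehigcb deijckf dejkagb dfghbka"
  ∷ "dfgicke dfgjikc dfhicjg dfikahj dghijbk dghkbif dgijacb dgikbef dhijakc efgibjd efgjhdb"
  ∷ "efhjkga efikdjh eghiakf eghjaic eghkdbi ehijkgc eijkacg fghijdk fghjdab fgijkad fgikhje"
  ∷ "fgjkeba fhjkica ghijafk ghikdje ghjkeda abcdek abcdgi abcdki abcefh abcegd abcehg abcfhg"
  ∷ "abcfih abchji abdehf abdejc abdfge abdfkh abdhig abdikj abefgi abeghf abfgij abfhkc abghke"
  ∷ "abgikd abhjkg acdefk acdehb acdfge acdghj acdgkh acdhkf acdije acdikg acefjb acegjk aceikf"
  ∷ "acfghd acfhid acfhke acfikd acghie acghjf acghke acgijk acgike acgjkb achijf acijkh adefhg"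
  ∷ "adegjc adfghb adfgih adfgjc adfijg adghic adgikh adhjkb aefgih aefhic aefjkg aehijk aehjkb"
  ∷ "afghkb afgije afhjki bcdfjg bcdfkj bcdhkj bcdikj bcdjke bcegjf bcehja bcejkg bcfhja bcfijd"
  ∷ "bcghik bcgikf bdefgj bdefik bdeghi bdegji bdegkf bdehjc bdeikj bdejka bdfgja bdfhic bdfhjk"
  ∷ "bdgijk bdgjkf bdhika befhig befijd begijc behjkc bfghik bfghji bfgika bfgjkc bfhjke bghije"
  ∷ "bghjkd cdeghk cdegia cdehjg cdfghj cdfhki cdfike cdgikb cdhikg cefghk cefgja cefgki cefijd"
  ∷ "cegjki cehijg cehikj cfghje cfgika cfgjke cghija cghikf defhia defhjb dehijk dfghie dfgikb"
  ∷ "dfgjkh dfhike dfhjki dfijka dhijkc efgikd eghijd eghikd"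
  ∷ []) ∷
  ( "ghibkdjcfea aiedjcfkgh bjadgeckhf cdagijebhk dicgfbkaje ebihfcgdaj fkagibchde hdjgefkiba"
  ∷ "iedcbkhafj jhbdfgciak kegifbachj abcjifehg acgedhfjb adihkjgcb aegkdbhci afhjkgbei"
  ∷ "agihedbkf ahdcjbfik ajhbcgfdk akehjcdig bcgkjhafi bdjcaehfi bfgaekjid bgdahjfie bhckjfade"
  ∷ "bifkcjehg bkfeadjci ceikhfjga cfdghiaek cgfkdbeha chkagjedf cihjbkdea cjekiadbg ckefiahbj"
  ∷ "decgibfja dfkigcjah dgifhkcbe djgbcekfi dkecabgfj efaicdkbg egijcbkah ehjagdkbf ejbhdiakf"
  ∷ "fgiahjdek fhkecdgjb ficjhdake fjcdkegih gibjdcehf gjebckfai gkcejhbdi hidgceajf hkejgfcba"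
  ∷ "ijcdfkebh ikdgajehb jkgahibfd abdekhfc abecdihg abfkjhec abgihejd abhkigfd abidghck"
  ∷ "abkjcgfd acejbfki acfjedbi achfjeki acijeghb acjdgfei ackfgjdh adefhick adfbkgej adgefbic"
  ∷ "adjihbgc adkfeghi aehdgbjf aejdkibg afgcdhbi afijdkgh afjgecih aghcjifk agjdfebc agkdceij"
  ∷ "ahiebfjd ahkjcifb aijhkebf aikbdcfh ajkicdbh bcdfjhkg bcedjhga bcfkjadi bcijdkeg bcjekiha"
  ∷ "bckiehgj bdejakhc bdfjkgci bdhfaegc bdigekhj bdkfghja befhgaji begfcjai behckgdi bekhdfci"
  ∷ "bfhgjcki bfjgiehk bgheakfd bgjhikca bgkiceda bhikfdeg bhkdgaij bijdache bikdeagf bjkegiah"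
  ∷ "cdgbakhj cdhijkfe cdjgikhf cdkgbhfa cefbaghi cegjahfb cehkafbg cfhbkieg cfkjhebd cghbjeak"
  ∷ "cgikhdaf cgjiafdb chjgifeb cikaehbg cjkdgaib defkicga degfbchj dehgkcij dejkbfia dfgkacej"
  ∷ "dfhecbai dfihekjb dfjahike dghackfe dgkhieac dhkefajb dijgebaf djkgifbe efgaijdk efhakjgc"
  ∷ "efibckdg efjdhcbi efkjadch eghjbdfi ehifakgc eijhackg eikdhafb ejkgfcia fgheidab fgjeidhc"
  ∷ "fgkbidaj fhiajced fhjkedbg fijbcegk fikhebag fjkbhigd ghjkdafe ghkecifd gijfhbca gikhaejf"
  ∷ "hijgdcfa hikdcbfj hjkbdfai ijkcbafg abcdihf abcfkeg abcgeji abchigf abcigjd abckigj"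
  ∷ "abdhkic abdkgjh abefhjd abegkih abehkcd abeijhc abejhkc abekicj abfhjid abfiegh abfjcdg"
  ∷ "abghcei abgjfkd abgkfcd abhidef abijfke acdejgh acdfigb acdijhg acdkieb acefhdk acehbif"
  ∷ "aceighk acekghb acfihbk acgifkd acgjbdh acgkjie achiedj achjibg acjkegf adekhgc adfgbji"
  ∷ "adfhcbk adfihkb adgijbk adhjefg adhkjei adikjbf adjkgec aefjdib aefkgjd aeghcfk aegijhd"
  ∷ "aegjbhk aeijfhk aeikdfb aejkbgc afghbij afhkijg afikdgh afjkgic aghjdck aghkbfd agijkef"
  ∷ "agikbjf ahikcbj bcdhage bcdigak bcdkahj bcegifk bceihjf bcekajd bcfgkih bcfiaed bcfjekd"
  ∷ "bcgifja bcgjihe bchifde bchjekd bcjkdfi bdefkig bdegacf bdehgfk bdeijfg bdekghj bdfgjec"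
  ∷ "bdfijgc bdghfai bdgkjca bdhifgj bdjkigc befjhki begihfd begkhjf beijghk beikhjd bfgiace"
  ∷ "bfhigcd bfhjidc bfhkgei bghkcai bgjkfei bhijefd bijkhaf cdefbka cdehgfi cdejhaf cdfhiak"
  ∷ "cdfibja cdfkaji cdghbie cdhjbgi cdhkaij cdikeha cefghjb cefhbaj cefijak cefjgid ceghbfk"
  ∷ "cegikab cehijdb cehjgdk ceijbad cfghjdk cfgiead cfgjikb cfhieag cfhjbia cfhkide cfikjhb"
  ∷ "cghiafk cghkfab cgjkieh chikbgd chjkgia defibcj degiabc degjbka degkiaf dehiajf dehjigc"
  ∷ "deijkhg dfghkei dfgjech dfhjcke dfhkajc dfijkbh dfjkhgi dhijbka dhjkcbg dijkceg efgidkj"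
  ∷ "efgkdbj efhjagi efijbag efikabc eghidbj ehikabd eijkfda fghickj fghjadc fghkibd fgikcea"
  ∷ "fgjkhca fhijdec fijkgeh gijkedb hijkced abcdfi abceig abcfgj abcfhj abcgke abchkf abdefj"
  ∷ "abdehj abdeij abdfij abdfjh abdhjk abdjkc abefjg abegij abfhid abfhki abfikd abghjf abgijf"
  ∷ "abgjkh abhijg abhjkc abijke acdefb acdehk acdeig acdfjh acdhig acdjkh acefgd acefkj acehjb"
  ∷ "acfghb acfgjh acfhki acfijd acfikb acfjkh acgikh adefib adegji adfghi adfgie adfjkb adghik"
  ∷ "adghkf aefghi aeghkf aegikf aegjkh aeijkf afghki afgijd afijkc aghijd bcdegh bcdeha bcdekj"
  ∷ "bcdfga bcdfhg bcdfka bcdhij bcdhkf bcdikg bcefkh bcegkd bcfghk bcfgjd bcghie bdefhi bdefjh"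
  ∷ "bdehic bdfgia bdfhka bdfikc bdghij bdghjk bdgika bdhike befgid befgjh befgkc befhka befikj"
  ∷ "befjka begikh behjkd beijkd bfijkg bghjkf bgijkc cdefgk cdefig cdefjb cdefka cdegji cdegki"
  ∷ "cdehif cdehkb cdeijb cdejka cdfgjk cdfhka cdfika cdghjk cdghkf cdgika cefgka cefhjb cefjki"
  ∷ "ceghif cehjkd cfgjkb defgha defijc defjkg degjkc dehjkg dfghji dfgijc dfgjka dfhikj dhijkg"
  ∷ "efghji efghkc efhijc eghijc eghikf ehijkf fhijkg ghijke"
  ∷ []) ∷
  ( "kbhafdcejig ahjcbeidgf bigekfhajd cgjkafeihd dbceahgfjk efcjigkhbd fbeigadkcj gabcfijhkd"
  ∷ "hfdcbegkia ijgeabcdkh jacbfhgeik abehgdfkc acihfjbde adgibfcje aedbfgjhk afjhdbkcg"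
  ∷ "aifdgkech akbicjdfg bceidafjk bedhckjfi bgkceifaj bhdaeijgk bjkcaegdf cdiekfjga cedjifhgk"
  ∷ "cfaiehdbk cheagbkij cigadbehf cjbgkeihd ckjahdgbi dekafbhij dfjichkga dgehcakbj dhkgeifab"
  ∷ "diekbgjfh djcheiafk dkbhajeic egkjhiacd ehdfbjiga eigfkjdah ejhbafkic ekfahdcjg fgdibjhac"
  ∷ "fidbhagck fjieacgdh fkjcbihad ghcikbafe gidjkcfbe gjfkcdebh gkfijbade hibedgfcj hjcbfdikg"
  ∷ "hkafjecbg ikhecdgab jkdfgihab abcidjgh abdgjfhk abfecjdh abhiegcj abiefkgj abjikhcd"
  ∷ "acdhbjgf acegbkdi acgkhifd achgijbk ackejhbg adfgkbjc adhgkejc adiekbfc adjgehci adkbifje"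
  ∷ "aefhbkgc aegfbcid aehgdfkc aeickjbd aejgkfhi aekjhifd afgjdkci afhckgdb afkbcjie aghfjkce"
  ∷ "agikdbhe agjhebif agkfjbed ahijdgke aijkfhbd aikchfed ajkbgcdi bcfdejik bcgehdik bchfaidk"
  ∷ "bcigkaej bckejdgh bdfhgikj bdgfchjk bdijgafe bdjgefkh begadjhc behgfijc beidgfkh bejkdhfa"
  ∷ "bekdhaic bfgejkha bfheiacg bfihjagk bfjiekhg bfkgcdhi bghjeckf bgjaecfk bhjkifde bijeakhg"
  ∷ "bikhcjgd cdfagbke cdgebfaj cdhbifke cdkbjahe cegifhka ceijahgf cejadigk cekjfghd cfgjhadk"
  ∷ "cfhibedj cfidkhaj cfjbdkae cfkebjgi cgkiajbf chikjfea chkgebif cijbgehd cikdabhg defghica"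
  ∷ "dejgcfah dfkcejai dghjfeak dgjkceib dgkcaijh dhikjaec dhjbcigf dijagekb dikbgcaf efghabid"
  ∷ "efhkjbci efiahjbc efjbcgdh eghkicjd egjfdakc ehijfgdk ehkbgadj eijdfgcb eikcbahf ejkhbgid"
  ∷ "fghjiacd fgicbeja fhidkagb fhjdbiae fhkjbgca fikcgjhb ghiafedj ghjcakif ghkifcde gikdefcb"
  ∷ "gjkhabdi hijdfkec hjkiedcb ijkechab abcdgej abceifk abcfdek abchgkj abckefh abdfghk"
  ∷ "abdihkj abdjike abejdig abekdch abfgkhj abfhikc abficjd abfjige abghide abgifkd abgkhdc"
  ∷ "abhjdgi acdehik acdghie acdifhj acdjbfh acdkjeh acefjgh acfghei acfjkeb acfkdei acgjfbk"
  ∷ "achkegi acijdfe adefchg adegcfi adehfbc adejifg adfhbcg adfjibe adfkicg adgkbei adhiefb"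
  ∷ "adhjcfk adhkeig adikhgc adjkebc aefjgih aegicdk aegkbjd aehicbd aehjcfi aehkbif aeijkdc"
  ∷ "aeikghb afgijke afhidgc afijhdg afikcej afjkebi aghkejb agijhbk agjkidf ahikjgf ahjkdfi"
  ∷ "bcdgkjf bcdifeg bcdjeai bcefgka bcehfja bcejidh bcfgjki bcfijgh bcfkdhe bcghkde bchijfe"
  ∷ "bchkajf bcikdfe bdefjik bdegkcf bdejigf bdfjaeh bdfkhjc bdghcjk bdgicfh bdgkfic bdhikcg"
  ∷ "bdjkghf befkdcj begjkdh begkfda beikagj bfghack bfgihak bfgjkdi bfhjgec bfhkedg bfikacd"
  ∷ "bfjkdic bghidca bghkied bgijekf bgikfca bgjkhid bhijadc bijkgda cdefjhk cdehigj cdekbia"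
  ∷ "cdfgehj cdfjagb cdghjai cdgiekb cdgjfbi cdhikja cdhkejg cdijbgk cdjkeib cefgkha cefhabg"
  ∷ "cefibja ceghjab cegjbdi cegkaif cehibdk cehjbdf cehkjga cfghbia cfgkhjd cfhjaki cfhkebi"
  ∷ "cfijagk cgijhkd chijebk chjkbdi cijkfeb defiakh defjach defkhgc degihjk degkcaj dehifja"
  ∷ "dehjbac dehkibj dejkfai dfghajk dfgjbhe dfgkeca dfhkgje dfikbha dghiaej dhjkeaf dijkafc"
  ∷ "efgkahi efhikdc efhjgab efikbhd efjkbda eghibcf eghjdcb egikjac fghidjc fghkebc fgijdac"
  ∷ "fhijceg fhikbgc fijkheg ghijebd gijkhfb abcdkg abcehk abceji abcgie abcgji abcgkf abchid"
  ∷ "abcijh abdeif abdfic abdfkc abdghc abdjkg abefji abefkg abegid abejkh abfgje abfhjg abfjkd"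
  ∷ "abghjc abgijk abgikh abhikc abhjkf acdeik acdekh acdfhg acdgje acdhik acdhkg acefgk acefkh"
  ∷ "acegji acfgie acfgkd acgijd achijk acijkf adefgk adegik adegkj adehjc adfhkc adfjkc adghjk"
  ∷ "adgjkc aefgid aefhjd aefikg aeghij aehijb aehikc afghkd afgikc afhike aghikf bcdgja bcdhka"
  ∷ "bcegid bcehkj bcfhka bcfike bcghia bcghjf bcijke bdefgh bdefih bdeghk bdfijc bdghje bdghkf"
  ∷ "bdhijg bdhjki bdijkc befhji behijd behikc beijkh bfghkc bfgijh bfijka bghijc cdefhi cdefia"
  ∷ "cdfghk cdfgia cdfgki cdfhig cdfhjg cdfhke cdfjki cdghij cdghke cdgijf cdgikh cdhija cdhjkg"
  ∷ "cdijka cefghb cefgjh cefhik cefhjk cefikg ceghia cegijh cegikj cegjka cfghia cfgijh cfhikb"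
  ∷ "cfhjkb cghjkb cgijkb defgic defhjk defikb degijc degjki dehija deijkb dfgikh dfhjkc dfijke"
  ∷ "dghijk dghikb dghjke efghik efgijb efgjkd efijka fghjke"
  ∷ []) ∷
  ( "dgbcieafhkj agfejbhcdi bchajkigfe cabekhidjg edjcfaibhk fcgbidjhka gbfdheiajk hecgakfjbd"
  ∷ "igfdkjaceb jgakdheifc khdcbiefgj abjhecfki adfjcikbe aekijbdfh afbgdchki ahikfgedc"
  ∷ "aijedgfcb ajfebdkgc akhefcigb bdhcjkaif behjgfdci bfcekadhg bhjgkcdfe biakfhecd bjciheagd"
  ∷ "bkegdicha cdbiehjfk cefdhajkb cgdkfhaji chdejbkag cibfhagej cjigfebdk ckaigfbed dfciheagj"
  ∷ "dhaebgkfi difehgkbj djkbcgiah dkgbhjafc efdajkgib egcdaijhk eijkbgcfa ejgdikhbc ekhgabjic"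
  ∷ "fgkhdbeja fhcejdika fihgkdjba fjbaheikg fkcgjiahe ghdcafekj gkaejdicb hicgdafbj hjdfeikgc"
  ∷ "ijhbfcgke ikjbdegah jkacbdgfi abdhcfej abefkjhd abgecfjd abhecdji abkcdeif acdbjhig"
  ∷ "acefbihj acfbhkge acgijekf achkdbif acibkefj acjgkedh adekbgcj adgfibhk adicbgfk adjbhfge"
  ∷ "adkjbihe aefkcigd aegckfdb aehcdgjf aeigfcbj aejhidkf afhigdkc afibgejh afkigedb aghbeidc"
  ∷ "agidckhe ahjicgdk aikjhdfb bcejgiak bcgihfek bckdgiha bdeghcak bdfkigjc bdifeagj bdjefcak"
  ∷ "bdkafieh befdgkic begcdjah beifahgk bejgdhci bfhdcija bfigdech bfkjeidc bghdaijf bgidkjha"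
  ∷ "bgjcdiae bgkjaeif bhifajkc bhkcfgje bijfgadk bikchfga bjkheaic cdeifbha cdijegbk cdjbfikh"
  ∷ "cdkjafhi ceibghjf cejhikbf cekhfgdi cfiajhgb cfjahbdk cghkiabe cgifdjke cgjedkfa cgkafbje"
  ∷ "chjdkefg chkiajge cikeadfj cjkbgahd degkhjba dehjgiaf deijbhga dekjifgb dfgjchei dfhibeja"
  ∷ "dfjbgcke dfkechia dgicjafh dgjahfik dhijecgk dijbhckg dikcbaje efgdkhja efhbjdkc efihbjkd"
  ∷ "efjhiadc efkcgbhd eghaicfj egihjfck egkchdbj ehiakdcj ehjibkgc eikbgcad ejkacifh fghdecba"
  ∷ "fgjbcadh fhjgback fhkcdbig fijabcgd fikgbjca fjkhgbie ghidbkea ghjekbca ghkajfie gijdbhfe"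
  ∷ "gikjfhcd gjkfbahi hikjbdec hjkaegfb abcgjek abcjedk abdejhi abdfjik abdgchi abdifhe"
  ∷ "abeidkh abejidc abekgfc abfhgki abfkhjc abgikfj abgjhed abgkcdf abhicjf abhkdec abijgck"
  ∷ "abjkedg acdefgb acdfbji acdgkjh acdhfib acdjeki acdkfbj aceibhg acejgdf acekhjg acfgejk"
  ∷ "acfhiej acfkbij acghkbd achidbe achjdei acijkbe adegbfk adeifhg adejgbi adfhijb adfijek"
  ∷ "adfkgjb adghfkb adgkifb adhijck adhjfek adhkgce adijckg adikcfh aefhigj aefijbc aegjhfd"
  ∷ "afghedb afgicde afgjkeb afgkhcj afhjgce afhkcdb afjkhce aghikbe aghjieb agijdkh agikebf"
  ∷ "bcdefgj bcdfiae bcehgaf bcekhdf bcfhjei bcfjkeh bcfkigd bcghaje bcgkhij bchiekf bchjgid"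
  ∷ "bdehfaj bdeihkf bdekcgj bdgjhac bdhicgf bdhjeka bdhkjaf bdikagc befghkj befjigk befkidc"
  ∷ "beghkca begidhc behikgc behkafc beijckf bejkcaf bfghcjd bfgkejd bfhjdce bfhkdea bfikjhc"
  ∷ "bghifje bghkaji bgijhac bgikjad bhikadf cdekhij cdfgakj cdfhgbk cdfjieb cdfkbeg cdgjkhe"
  ∷ "cdhieag cefgbhj cefigdj cefjakd cegiakd cehigja ceijgkd cejkdbi cfghkia cfgjadh cfhikeg"
  ∷ "cfhjdai cfijkah cfikahb cfjkedi cghjefk cgikfda cgjkhei chijfkd chjkeba cijkdhg defhakg"
  ∷ "defjiba deghiak degikhc dehikfa dehkacf deikagb dfgkjch dfhkjbg dfijgbe dfikcba dfjkcbh"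
  ∷ "dghjife dghkcif dgikhab dgjkhfa dhikbfg dhjkace dijkhfb efghcid efgihbk efgjbda efgkjic"
  ∷ "efhkgab efijgak efikgcb efjkdbc egijkhf egikcdf egjkcfb ehikjac ehjkfci fgijace fhijagb"
  ∷ "fhikjae fijkaeb ghijfcd ghikeac ghjkiae abcdeg abcfgh abcfig abcfje abcgik abchki abcije"
  ∷ "abdefc abdfhg abdgie abdgjc abdgkh abdhij abdijg abefgh abefhc abegic abegji abehik abeikf"
  ∷ "abfgjd abfgkd abfjkc abghif abhije abhjki abijkf acdeib acdekf acdfie acdgjh acefhg acefij"
  ∷ "acehik acehji aceijd acfghi acfjkg acghib acghje achjkg adefgj adefki adeghk adegif adegkc"
  ∷ "adehib adehjg adejkh adfgji adfhkb adfikj adfjkh adghij adhikf adijke aefgkd aefhjc aefikh"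
  ∷ "aefjkh aegijk agijkf bcdehf bcdeji bcdfgk bcdghk bcdija bcefhk bcefig bcefji bcegka bcehjg"
  ∷ "bceikf bcfgkj bcfijk bcgijf bcgikj bchjki bcijkd bdefka bdehkg bdeikc bdejkg bdfgkj bdfijk"
  ∷ "bdfjka bdgjka befgik befhkj beghij begijd begjkc bfghki bfhike bfhjkc bghikj cdefgj cdeghj"
  ∷ "cdegih cdegkf cdeikj cdghjb cdgikj cdhijf cdhika cefgjb cefhib cefijh cefikd cehikg ceijkf"
  ∷ "cfghid cfghjk cfhjkd cghijd cgijka chijkg defgij defgjh defhkj defikg degjkf dehjki dfghib"
  ∷ "dfghjb dfhijb dfhikc dfijkc dgijkh efghjk efhikg efijkh"
  ∷ []) ∷
  []

family-10 : Family 5 10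
family-10 = familyᵇ-sound (Vec.map decode words-10) refl

family-11 : Family 5 11
family-11 = familyᵇ-sound (Vec.map decode words-11) refl

-- Sums of tens and elevens

-- Write n = 10 q + r with r ≤ 9. Replacing r of the q tens by elevens absorbs the remainder. This
-- needs r ≤ q, and n ≥ 90 gives q ≥ 9. The inequality is also what makes the truncated difference
-- `q ∸ r` a true one.
10-11-combination : ∀ n → n ≥ 90 → (n / 10 ∸ n % 10) * 10 + n % 10 * 11 ≡ n
10-11-combination n n≥90 = begin
  (q ∸ r) * 10 + r * 11       ≡⟨ cong ((q ∸ r) * 10 +_) (*-suc r 10) ⟩
  (q ∸ r) * 10 + (r + r * 10) ≡⟨ x∙yz≈y∙xz +-commutativeSemigroup ((q ∸ r) * 10) r (r * 10) ⟩
  r + ((q ∸ r) * 10 + r * 10) ≡⟨ cong (r +_) (*-distribʳ-+ 10 (q ∸ r) r) ⟨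
  r + (q ∸ r + r) * 10        ≡⟨ cong (λ s → r + s * 10) (m∸n+n≡m r≤q) ⟩
  r + q * 10                  ≡⟨ m≡m%n+[m/n]*n n 10 ⟨
  n                           ∎
  where
  open ≡-Reasoning
  q = n / 10
  r = n % 10
  r≤q : r ≤ q
  r≤q = ≤-trans (s≤s⁻¹ (m%n<n n 10)) (/-monoˡ-≤ 10 n≥90)

theorem2 : ∀ (n : ℕ) → n ≥ 90 →
    ∃ λ (D : Fin 5 → SCD n) → ∀ (i j : Fin 5) → i ≢ j → EdgeDisjoint (D i) (D j)
theorem2 n n≥90 = subst (Family 5) (10-11-combination n n≥90)
  (family-+ (family-* (n / 10 ∸ n % 10) family-10) (family-* (n % 10) family-11))
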